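{- Let $d\ge 1$, let $V$ be a $d$-dimensional real inner-product space, $\mathcal L\subset V$ a full-rank lattice, $\boldsymbol\alpha\in V$, and let $q_1<q_2<\cdots$ be the (finite or infinite) sequence of best approximation denominators of $\boldsymbol\alpha$ with respect to $\mathcal L$. Put $M=2^d$. For every $n\ge 1$ such that $q_{n+M}$ is defined, at least one of the following alternatives holds: (1) $q_{n+M}\ge 2q_{n+1}$; (2) the set $\{1,\ldots,M\}$ can be partitioned into disjoint pairs $\{j,k\}$, $j<k$, such that each pair of the partition satisfies $q_{n+k}=q_n+q_{n+j}$. Consequently, for every $n\ge1$ such that $q_{n+M}$ is defined, $$ q_{n+M}\ge \min\{2q_{n+1},\ q_n+q_{n+M/2}\}\ge q_n+q_{n+1}>2q_n. $$
   Context: Let $\|\cdot\|$ be the norm induced by the inner product of $V$; a full-rank lattice is a discrete subgroup spanning $V$. For integers $q\ge 1$ put $\rho(q)=\min_{p\in\mathcal L}\|q\boldsymbol\alpha-p\|$, the distance from $q\boldsymbol\alpha$ to $\mathcal L$. The best approximation denominators are defined by $q_1=1$ and $$q_{n+1}=\min\{q\in\mathbb Z: q>q_n,\ \rho(q)<\rho(q_n)\}$$ whenever the set on the right is nonempty; if it is empty, the sequence terminates at $q_n$. (The sequence is infinite if $\boldsymbol\alpha+\mathcal L$ has infinite order in $V/\mathcal L$, and otherwise terminates at a denominator with $\rho=0$.) -}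

module Defs where

open import Algebra.Bundles using (CommutativeRing)
open import Algebra.Module.Bundles using (Module)
import Algebra.Properties.CommutativeMonoid.Sum as Sum
import Algebra.Properties.Monoid.Mult as Mult
open import Data.Fin.Base using (Fin)
open import Data.List.Base using (List; []; _∷_; concatMap; applyUpTo)
open import Data.List.Relation.Binary.Permutation.Propositional using (_↭_)
open import Data.List.Relation.Unary.All using (All)
open import Data.Nat.Base as ℕ using (ℕ; zero; suc)
import Data.Nat.Properties as ℕ
open import Data.Product.Base using (Σ; ∃; ∃-syntax; _×_; _,_)
open import Data.Rational.Base as ℚ using (ℚ; 0ℚ; 1ℚ; ½; ∣_∣; Positive)
import Data.Rational.Properties as ℚ
open import Data.Rational.Solver using (module +-*-Solver)
open import Level using (Level; 0ℓ) renaming (suc to lsuc; _⊔_ to _⊔ˡ_)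
open import Relation.Binary.PropositionalEquality.Core
  using (_≡_; refl; sym; trans; cong; subst; subst₂)
open import Relation.Nullary.Negation.Core using (¬_)

------------------------------------------------------------------------
-- Real numbers: Cauchy sequences of rationals, equal when their
-- difference tends to 0.

IsCauchy : (ℕ → ℚ) → Set
IsCauchy x = ∀ ε → 0ℚ ℚ.< ε →
  ∃[ N ] (∀ m n → N ℕ.≤ m → N ℕ.≤ n → ∣ x m ℚ.- x n ∣ ℚ.< ε)

IsNull : (ℕ → ℚ) → Set
IsNull x = ∀ ε → 0ℚ ℚ.< ε → ∃[ N ] (∀ n → N ℕ.≤ n → ∣ x n ∣ ℚ.< ε)

record ℝ : Set where
  constructor mkℝ
  field
    seq    : ℕ → ℚ
    cauchy : IsCauchy seq

open ℝ public

infix 4 _≈ᴿ_ _<ᴿ_ _≤ᴿ_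

_≈ᴿ_ : ℝ → ℝ → Set
x ≈ᴿ y = IsNull (λ n → seq x n ℚ.- seq y n)

_<ᴿ_ : ℝ → ℝ → Set
x <ᴿ y = ∃[ ε ] (0ℚ ℚ.< ε × ∃[ N ] (∀ n → N ℕ.≤ n → seq x n ℚ.+ ε ℚ.≤ seq y n))

_≤ᴿ_ : ℝ → ℝ → Set
x ≤ᴿ y = ¬ (y <ᴿ x)

module CauchyLemmas where

  half-pos : ∀ {ε} → 0ℚ ℚ.< ε → 0ℚ ℚ.< ½ ℚ.* ε
  half-pos {ε} 0<ε =
    subst (ℚ._< ½ ℚ.* ε) (ℚ.*-zeroʳ ½) (ℚ.*-monoʳ-<-pos ½ 0<ε)

  halves : ∀ ε → ½ ℚ.* ε ℚ.+ ½ ℚ.* ε ≡ ε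
  halves = solve 1 (λ e → con ½ :* e :+ con ½ :* e := e) refl
    where open +-*-Solver

  ∣∣-resp : ∀ {a b ε} → a ≡ b → ∣ a ∣ ℚ.< ε → ∣ b ∣ ℚ.< ε
  ∣∣-resp {ε = ε} eq = subst (λ c → ∣ c ∣ ℚ.< ε) eq

  add-small : ∀ {a b ε} → ∣ a ∣ ℚ.< ½ ℚ.* ε → ∣ b ∣ ℚ.< ½ ℚ.* ε → ∣ a ℚ.+ b ∣ ℚ.< ε
  add-small {a} {b} {ε} a< b< =
    ℚ.≤-<-trans (ℚ.∣p+q∣≤∣p∣+∣q∣ a b)
      (subst (∣ a ∣ ℚ.+ ∣ b ∣ ℚ.<_) (halves ε) (ℚ.+-mono-< a< b<))

  -- For B > 0, a factor bounded by B times one below δ is below ε.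
  record Factor (B ε : ℚ) : Set where
    field
      δ   : ℚ
      0<δ : 0ℚ ℚ.< δ
      mul : ∀ {a b} → ∣ a ∣ ℚ.< B → ∣ b ∣ ℚ.< δ → ∣ a ℚ.* b ∣ ℚ.< ε

  factor : ∀ B ε → 0ℚ ℚ.< B → 0ℚ ℚ.< ε → Factor B ε
  factor B ε 0<B 0<ε = record { δ = δ ; 0<δ = 0<δ ; mul = mul }
    where
    instance
      posB : Positive B
      posB = ℚ.positive 0<B
      nzB : ℚ.NonZero B
      nzB = ℚ.pos⇒nonZero B
      posε : Positive ε
      posε = ℚ.positive 0<ε
      pos1/B : Positive (ℚ.1/ B)
      pos1/B = ℚ.1/pos⇒pos B
    δ : ℚ
    δ = ℚ.1/ B ℚ.* ε
    instance
      posδ : Positive δ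
      posδ = ℚ.pos*pos⇒pos (ℚ.1/ B) ε
    0<δ : 0ℚ ℚ.< δ
    0<δ = ℚ.positive⁻¹ δ
    Bδ≡ε : B ℚ.* δ ≡ ε
    Bδ≡ε = trans (sym (ℚ.*-assoc B (ℚ.1/ B) ε))
             (trans (cong (ℚ._* ε) (ℚ.*-inverseʳ B)) (ℚ.*-identityˡ ε))
    mul : ∀ {a b} → ∣ a ∣ ℚ.< B → ∣ b ∣ ℚ.< δ → ∣ a ℚ.* b ∣ ℚ.< ε
    mul {a} {b} a< b< =
      subst₂ ℚ._<_ (sym (ℚ.∣p*q∣≡∣p∣*∣q∣ a b)) Bδ≡ε
        (ℚ.≤-<-trans
          (ℚ.*-monoˡ-≤-nonNeg ∣ a ∣ {{ℚ.∣-∣-nonNeg a}} (ℚ.<⇒≤ b<))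
          (ℚ.*-monoˡ-<-pos δ a<))

  bound : ∀ x → IsCauchy x →
    ∃[ B ] (0ℚ ℚ.< B × ∃[ N ] (∀ n → N ℕ.≤ n → ∣ x n ∣ ℚ.< B))
  bound x cx with cx 1ℚ (ℚ.positive⁻¹ 1ℚ)
  ... | N , hN = B , 0<B , N , λ n N≤n →
      ∣∣-resp (solve 2 (λ a b → (a :- b) :+ b := a) refl (x n) (x N))
        (ℚ.≤-<-trans (ℚ.∣p+q∣≤∣p∣+∣q∣ (x n ℚ.- x N) (x N))
          (ℚ.+-monoˡ-< ∣ x N ∣ (hN n N N≤n ℕ.≤-refl)))
    where
    open +-*-Solver
    B : ℚ
    B = 1ℚ ℚ.+ ∣ x N ∣
    0<B : 0ℚ ℚ.< B
    0<B = ℚ.+-mono-<-≤ (ℚ.positive⁻¹ 1ℚ) (ℚ.0≤∣p∣ (x N))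

  ⊔ˡ-≤ : ∀ {m n o} → m ℕ.⊔ n ℕ.≤ o → m ℕ.≤ o
  ⊔ˡ-≤ {m} {n} = ℕ.m⊔n≤o⇒m≤o m n

  ⊔ʳ-≤ : ∀ {m n o} → m ℕ.⊔ n ℕ.≤ o → n ℕ.≤ o
  ⊔ʳ-≤ {m} {n} = ℕ.m⊔n≤o⇒n≤o m n

  null-resp : ∀ {x y} → (∀ n → x n ≡ y n) → IsNull x → IsNull y
  null-resp x≡y hx ε 0<ε =
    let N , h = hx ε 0<ε in N , λ n N≤n → ∣∣-resp (x≡y n) (h n N≤n)

  null-+ : ∀ {x y} → IsNull x → IsNull y → IsNull (λ n → x n ℚ.+ y n)
  null-+ {x} {y} hx hy ε 0<ε =
    let M , f = hx (½ ℚ.* ε) (half-pos 0<ε)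
        N , g = hy (½ ℚ.* ε) (half-pos 0<ε)
    in M ℕ.⊔ N , λ n le → add-small {x n} {y n} (f n (⊔ˡ-≤ le)) (g n (⊔ʳ-≤ {M} le))

  null-neg : ∀ {x} → IsNull x → IsNull (λ n → ℚ.- x n)
  null-neg {x} hx ε 0<ε =
    let N , h = hx ε 0<ε in N , λ n le → subst (ℚ._< ε) (sym (ℚ.∣-p∣≡∣p∣ (x n))) (h n le)

  null-* : ∀ {x y} → IsCauchy x → IsNull y → IsNull (λ n → x n ℚ.* y n)
  null-* {x} {y} cx hy ε 0<ε =
    let B , 0<B , M , f = bound x cx
        F = factor B ε 0<B 0<ε
        N , g = hy (Factor.δ F) (Factor.0<δ F)
    in M ℕ.⊔ N , λ n le → Factor.mul F {x n} {y n} (f n (⊔ˡ-≤ le)) (g n (⊔ʳ-≤ {M} le))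

  cauchy-const : ∀ q → IsCauchy (λ _ → q)
  cauchy-const q ε 0<ε = 0 , λ _ _ _ _ → ∣∣-resp (sym (ℚ.+-inverseʳ q)) 0<ε

  cauchy-+ : ∀ {x y} → IsCauchy x → IsCauchy y → IsCauchy (λ n → x n ℚ.+ y n)
  cauchy-+ {x} {y} cx cy ε 0<ε =
    let M , f = cx (½ ℚ.* ε) (half-pos 0<ε)
        N , g = cy (½ ℚ.* ε) (half-pos 0<ε)
    in M ℕ.⊔ N , λ m n lm ln →
    ∣∣-resp
      (solve 4 (λ a b c d → (a :- b) :+ (c :- d) := (a :+ c) :- (b :+ d)) refl
        (x m) (x n) (y m) (y n))
      (add-small {x m ℚ.- x n} {y m ℚ.- y n}
        (f m n (⊔ˡ-≤ lm) (⊔ˡ-≤ ln)) (g m n (⊔ʳ-≤ {M} lm) (⊔ʳ-≤ {M} ln)))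
    where open +-*-Solver

  cauchy-neg : ∀ {x} → IsCauchy x → IsCauchy (λ n → ℚ.- x n)
  cauchy-neg {x} cx ε 0<ε =
    let N , h = cx ε 0<ε in N , λ m n lm ln →
    ∣∣-resp (solve 2 (λ a b → b :- a := (:- a) :- (:- b)) refl (x m) (x n)) (h n m ln lm)
    where open +-*-Solver

  cauchy-* : ∀ {x y} → IsCauchy x → IsCauchy y → IsCauchy (λ n → x n ℚ.* y n)
  cauchy-* {x} {y} cx cy ε 0<ε =
    let B , 0<B , N₁ , f₁ = bound x cx
        C , 0<C , N₂ , f₂ = bound y cy
        F = factor B (½ ℚ.* ε) 0<B (half-pos 0<ε)
        G = factor C (½ ℚ.* ε) 0<C (half-pos 0<ε)
        N₃ , f₃ = cy (Factor.δ F) (Factor.0<δ F)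
        N₄ , f₄ = cx (Factor.δ G) (Factor.0<δ G)
    in (N₁ ℕ.⊔ N₂) ℕ.⊔ (N₃ ℕ.⊔ N₄) , λ m n lm ln →
    ∣∣-resp
      (solve 4 (λ a b c d → a :* (c :- d) :+ d :* (a :- b) := a :* c :- b :* d) refl
        (x m) (x n) (y m) (y n))
      (add-small {x m ℚ.* (y m ℚ.- y n)} {y n ℚ.* (x m ℚ.- x n)}
        (Factor.mul F {x m} {y m ℚ.- y n}
          (f₁ m (⊔ˡ-≤ {N₁} (⊔ˡ-≤ lm)))
          (f₃ m n (⊔ˡ-≤ {N₃} (⊔ʳ-≤ {N₁ ℕ.⊔ N₂} lm)) (⊔ˡ-≤ {N₃} (⊔ʳ-≤ {N₁ ℕ.⊔ N₂} ln))))
        (Factor.mul G {y n} {x m ℚ.- x n}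
          (f₂ n (⊔ʳ-≤ {N₁} (⊔ˡ-≤ ln)))
          (f₄ m n (⊔ʳ-≤ {N₃} (⊔ʳ-≤ {N₁ ℕ.⊔ N₂} lm)) (⊔ʳ-≤ {N₃} (⊔ʳ-≤ {N₁ ℕ.⊔ N₂} ln)))))
    where open +-*-Solver

open CauchyLemmas

infix  8 -ᴿ_
infixl 7 _*ᴿ_
infixl 6 _+ᴿ_

_+ᴿ_ : ℝ → ℝ → ℝ
x +ᴿ y = mkℝ (λ n → seq x n ℚ.+ seq y n) (cauchy-+ {seq x} {seq y} (cauchy x) (cauchy y))

_*ᴿ_ : ℝ → ℝ → ℝ
x *ᴿ y = mkℝ (λ n → seq x n ℚ.* seq y n) (cauchy-* {seq x} {seq y} (cauchy x) (cauchy y))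

-ᴿ_ : ℝ → ℝ
-ᴿ x = mkℝ (λ n → ℚ.- seq x n) (cauchy-neg {seq x} (cauchy x))

fromℚ : ℚ → ℝ
fromℚ q = mkℝ (λ _ → q) (cauchy-const q)

0ᴿ 1ᴿ : ℝ
0ᴿ = fromℚ 0ℚ
1ᴿ = fromℚ 1ℚ

module ℝ-Laws where

  pointwise : ∀ {x y} → (∀ n → seq x n ≡ seq y n) → x ≈ᴿ y
  pointwise {x} {y} x≡y ε 0<ε = 0 , λ n _ →
    ∣∣-resp (sym (trans (cong (ℚ._- seq y n) (x≡y n)) (ℚ.+-inverseʳ (seq y n)))) 0<ε

  ≈-sym : ∀ {x y} → x ≈ᴿ y → y ≈ᴿ x
  ≈-sym {x} {y} x≈y =
    null-resp (λ n → solve 2 (λ a b → :- (a :- b) := b :- a) refl (seq x n) (seq y n))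
      (null-neg x≈y)
    where open +-*-Solver

  ≈-trans : ∀ {x y z} → x ≈ᴿ y → y ≈ᴿ z → x ≈ᴿ z
  ≈-trans {x} {y} {z} x≈y y≈z =
    null-resp
      (λ n → solve 3 (λ a b c → (a :- b) :+ (b :- c) := a :- c) refl
        (seq x n) (seq y n) (seq z n))
      (null-+ x≈y y≈z)
    where open +-*-Solver

  +-cong : ∀ {x x′ y y′} → x ≈ᴿ x′ → y ≈ᴿ y′ → x +ᴿ y ≈ᴿ x′ +ᴿ y′
  +-cong {x} {x′} {y} {y′} p q =
    null-resp
      (λ n → solve 4 (λ a b c d → (a :- b) :+ (c :- d) := (a :+ c) :- (b :+ d)) refl
        (seq x n) (seq x′ n) (seq y n) (seq y′ n))
      (null-+ p q)
    where open +-*-Solver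

  *-cong : ∀ {x x′ y y′} → x ≈ᴿ x′ → y ≈ᴿ y′ → x *ᴿ y ≈ᴿ x′ *ᴿ y′
  *-cong {x} {x′} {y} {y′} p q =
    null-resp
      (λ n → solve 4 (λ a b c d → a :* (c :- d) :+ d :* (a :- b) := a :* c :- b :* d) refl
        (seq x n) (seq x′ n) (seq y n) (seq y′ n))
      (null-+ (null-* {seq x} {λ n → seq y n ℚ.- seq y′ n} (cauchy x) q)
              (null-* {seq y′} {λ n → seq x n ℚ.- seq x′ n} (cauchy y′) p))
    where open +-*-Solver

  neg-cong : ∀ {x y} → x ≈ᴿ y → -ᴿ x ≈ᴿ -ᴿ y
  neg-cong {x} {y} p =
    null-resp (λ n → ℚ.neg-distrib-+ (seq x n) (ℚ.- seq y n)) (null-neg p)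

open ℝ-Laws

ℝ-commutativeRing : CommutativeRing 0ℓ 0ℓ
ℝ-commutativeRing = record
  { Carrier = ℝ
  ; _≈_ = _≈ᴿ_
  ; _+_ = _+ᴿ_
  ; _*_ = _*ᴿ_
  ; -_ = -ᴿ_
  ; 0# = 0ᴿ
  ; 1# = 1ᴿ
  ; isCommutativeRing = record
    { isRing = record
      { +-isAbelianGroup = record
        { isGroup = record
          { isMonoid = record
            { isSemigroup = record
              { isMagma = record
                { isEquivalence = record
                  { refl = λ {x} → pointwise {x} {x} (λ _ → refl)
                  ; sym = λ {x} {y} → ≈-sym {x} {y}
                  ; trans = λ {x} {y} {z} → ≈-trans {x} {y} {z}
                  }
                ; ∙-cong = λ {x} {x′} {y} {y′} → +-cong {x} {x′} {y} {y′}
                }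
              ; assoc = λ x y z → pointwise {(x +ᴿ y) +ᴿ z} {x +ᴿ (y +ᴿ z)}
                  (λ n → ℚ.+-assoc (seq x n) (seq y n) (seq z n))
              }
            ; identity =
                (λ x → pointwise {0ᴿ +ᴿ x} {x} (λ n → ℚ.+-identityˡ (seq x n)))
              , (λ x → pointwise {x +ᴿ 0ᴿ} {x} (λ n → ℚ.+-identityʳ (seq x n)))
            }
          ; inverse =
              (λ x → pointwise { -ᴿ x +ᴿ x} {0ᴿ} (λ n → ℚ.+-inverseˡ (seq x n)))
            , (λ x → pointwise {x +ᴿ -ᴿ x} {0ᴿ} (λ n → ℚ.+-inverseʳ (seq x n)))
          ; ⁻¹-cong = λ {x} {y} → neg-cong {x} {y}
          }
        ; comm = λ x y → pointwise {x +ᴿ y} {y +ᴿ x}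
            (λ n → ℚ.+-comm (seq x n) (seq y n))
        }
      ; *-cong = λ {x} {x′} {y} {y′} → *-cong {x} {x′} {y} {y′}
      ; *-assoc = λ x y z → pointwise {(x *ᴿ y) *ᴿ z} {x *ᴿ (y *ᴿ z)}
          (λ n → ℚ.*-assoc (seq x n) (seq y n) (seq z n))
      ; *-identity =
          (λ x → pointwise {1ᴿ *ᴿ x} {x} (λ n → ℚ.*-identityˡ (seq x n)))
        , (λ x → pointwise {x *ᴿ 1ᴿ} {x} (λ n → ℚ.*-identityʳ (seq x n)))
      ; distrib =
          (λ x y z → pointwise {x *ᴿ (y +ᴿ z)} {x *ᴿ y +ᴿ x *ᴿ z}
            (λ n → ℚ.*-distribˡ-+ (seq x n) (seq y n) (seq z n)))
        , (λ x y z → pointwise {(y +ᴿ z) *ᴿ x} {y *ᴿ x +ᴿ z *ᴿ x}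
            (λ n → ℚ.*-distribʳ-+ (seq x n) (seq y n) (seq z n)))
      }
    ; *-comm = λ x y → pointwise {x *ᴿ y} {y *ᴿ x}
        (λ n → ℚ.*-comm (seq x n) (seq y n))
    }
  }

------------------------------------------------------------------------
-- Real inner-product spaces and lattices

record InnerProductSpace (c ℓ : Level) : Set (lsuc (c ⊔ˡ ℓ)) where
  infix 8 ⟨_,_⟩
  field
    vectorSpace : Module ℝ-commutativeRing c ℓ

  open Module vectorSpace public

  field
    ⟨_,_⟩      : Carrierᴹ → Carrierᴹ → ℝ
    ⟨⟩-cong    : ∀ {u u′ v v′} → u ≈ᴹ u′ → v ≈ᴹ v′ → ⟨ u , v ⟩ ≈ᴿ ⟨ u′ , v′ ⟩
    ⟨⟩-sym     : ∀ u v → ⟨ u , v ⟩ ≈ᴿ ⟨ v , u ⟩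
    ⟨⟩-+ˡ      : ∀ u v w → ⟨ u +ᴹ v , w ⟩ ≈ᴿ ⟨ u , w ⟩ +ᴿ ⟨ v , w ⟩
    ⟨⟩-*ˡ      : ∀ r u v → ⟨ r *ₗ u , v ⟩ ≈ᴿ r *ᴿ ⟨ u , v ⟩
    ⟨⟩-nonNeg  : ∀ v → 0ᴿ ≤ᴿ ⟨ v , v ⟩
    ⟨⟩-definite : ∀ v → ⟨ v , v ⟩ ≈ᴿ 0ᴿ → v ≈ᴹ 0ᴹ

    -- ‖ v ‖ is the square root of ⟨ v , v ⟩, specified by its two defining
    -- properties, which determine it uniquely.
    ‖_‖        : Carrierᴹ → ℝ
    ‖‖-nonNeg  : ∀ v → 0ᴿ ≤ᴿ ‖ v ‖
    ‖‖-square  : ∀ v → ‖ v ‖ *ᴿ ‖ v ‖ ≈ᴿ ⟨ v , v ⟩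

  infixl 6 _-ᴹ_
  _-ᴹ_ : Carrierᴹ → Carrierᴹ → Carrierᴹ
  u -ᴹ v = u +ᴹ (-ᴹ v)

  -- n × v is v + ⋯ + v with n summands.
  open Mult +ᴹ-monoid public using (_×_)

  linearCombination : ∀ {k} → (Fin k → ℝ) → (Fin k → Carrierᴹ) → Carrierᴹ
  linearCombination r v = Sum.sum +ᴹ-commutativeMonoid (λ i → r i *ₗ v i)

module _ {c ℓ} (V : InnerProductSpace c ℓ) where
  open InnerProductSpace V renaming (_×_ to _·_)

  record IsBasis {d} (b : Fin d → Carrierᴹ) : Set (c ⊔ˡ ℓ) where
    field
      independent : ∀ r → linearCombination r b ≈ᴹ 0ᴹ → ∀ i → r i ≈ᴿ 0ᴿ
      spanning    : ∀ v → ∃[ r ] v ≈ᴹ linearCombination r b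

  HasDimension : ℕ → Set (c ⊔ˡ ℓ)
  HasDimension d = Σ (Fin d → Carrierᴹ) IsBasis

  record IsFullRankLattice {p} (L : Carrierᴹ → Set p) : Set (c ⊔ˡ ℓ ⊔ˡ p) where
    field
      resp     : ∀ {u v} → u ≈ᴹ v → L u → L v
      0-closed : L 0ᴹ
      +-closed : ∀ {u v} → L u → L v → L (u +ᴹ v)
      neg-closed : ∀ {v} → L v → L (-ᴹ v)
      discrete : ∀ u → L u → ∃[ ε ] (0ᴿ <ᴿ ε × (∀ v → L v → ‖ v -ᴹ u ‖ <ᴿ ε → v ≈ᴹ u))
      spanning : ∀ v → ∃[ k ] Σ (Fin k → ℝ) λ r → Σ (Fin k → Carrierᴹ) λ u →
                   (∀ i → L (u i)) × v ≈ᴹ linearCombination r u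

  record IsDistanceToLattice {p} (L : Carrierᴹ → Set p) (α : Carrierᴹ)
                             (ρ : ℕ → ℝ) : Set (c ⊔ˡ p) where
    field
      attained   : ∀ q → 1 ℕ.≤ q → ∃[ v ] (L v × ρ q ≈ᴿ ‖ q · α -ᴹ v ‖)
      lowerBound : ∀ q → 1 ℕ.≤ q → ∀ v → L v → ρ q ≤ᴿ ‖ q · α -ᴹ v ‖

------------------------------------------------------------------------
-- Best approximation denominators

IsMinimum : (ℕ → Set) → ℕ → Set
IsMinimum P m = P m × (∀ k → P k → m ℕ.≤ k)

-- BestDenominator ρ n q says that the n-th term (counting from 1) is
-- defined and equals q; the sequence stops at q when no m can be supplied
-- to `next`.
data BestDenominator (ρ : ℕ → ℝ) : ℕ → ℕ → Set where
  first : BestDenominator ρ 1 1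
  next  : ∀ {n q m} → BestDenominator ρ n q →
          IsMinimum (λ k → q ℕ.< k × ρ k <ᴿ ρ q) m →
          BestDenominator ρ (suc n) m

-- Partitions of {1,…,M} into disjoint pairs {j,k}, j < k, each satisfying R j k.
PairPartition : ℕ → (ℕ → ℕ → Set) → Set
PairPartition M R = Σ (List (ℕ × ℕ)) λ pairs →
  concatMap (λ { (j , k) → j ∷ k ∷ [] }) pairs ↭ applyUpTo suc M ×
  All (λ { (j , k) → j ℕ.< k × R j k }) pairs

{-# OPTIONS --safe #-}
module Submission where

-- Let x_i = (q_i , p_i) ∈ ℤ × L, where p_i is a lattice point nearest to q_i α,
-- for n ≤ i ≤ n + M, and suppose q_{n+M} < 2 q_{n+1}. If two of the x_i, or one
-- of them and 0, agree modulo 2, then half of their difference approximates α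
-- too well. If i < j < l and x_i + x_j + x_l vanishes modulo 2, then halves of the
-- signed sums of the three error vectors are approximations, and the parallelogram law
-- again gives a contradiction unless q_l = q_i + q_j, which forces i = n. So
-- T = {x_{n+1}, …, x_{n+M}} is sum-free modulo 2. The subgroup generated by the p_i
-- has at most 2^d classes modulo 2L (by a pigeonhole argument, as L is discrete), so
-- that T occupies half of the available classes; for t ∈ T the set t + T is disjoint
-- from T, hence contains x_n. Therefore t ↦ x_n - t is an involution of T modulo 2,
-- and its orbits are the required pairs.

open import Defs
open import Algebra.Bundles using (CommutativeRing)
open import Algebra.Module.Bundles using (Module)
import Algebra.Properties.AbelianGroup as AbelianGroupProperties
import Algebra.Properties.CommutativeMonoid.Mult as CommutativeMonoidMult
import Algebra.Properties.CommutativeMonoid.Sum as CommutativeMonoidSum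
import Algebra.Properties.Monoid.Mult as MonoidMult
import Algebra.Solver.CommutativeMonoid as CommutativeMonoidSolver
import Algebra.Solver.Ring.NaturalCoefficients.Default as SemiringSolver
open import Data.Empty using (⊥; ⊥-elim)
open import Data.Fin.Base as Fin using (Fin; zero; suc; toℕ; funToFin; finToFun; combine; fromℕ<; splitAt; join)
import Data.Fin.Properties as Fin
open import Data.Integer.Base as ℤ using (+_; -[1+_])
import Data.Integer.Properties as ℤ
import Data.Integer.Solver as ℤSolver
open import Data.List.Base as List using (List; []; _∷_; concatMap; applyUpTo; map; length; tabulate; allFin)
open import Data.List.Membership.Propositional using (_∈_)
open import Data.List.Membership.Propositional.Properties using (∈-allFin; ∈-∃++)
import Data.List.Properties as List
open import Data.List.Relation.Binary.Permutation.Propositional as Perm using (_↭_; ↭-sym; ↭-trans; ↭-refl; ↭-reflexive; ↭-prep; ↭-swap)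
import Data.List.Relation.Binary.Permutation.Propositional.Properties as Perm
import Data.List.Relation.Binary.Permutation.Setoid.Properties as PermSetoid
open import Data.List.Relation.Unary.All using (All; []; _∷_)
open import Data.List.Relation.Unary.AllPairs using (_∷_)
open import Data.List.Relation.Unary.Any using (here; there)
open import Data.List.Relation.Unary.Unique.Propositional using (Unique)
open import Data.List.Relation.Unary.Unique.Propositional.Properties using (allFin⁺; Unique[x∷xs]⇒x∉xs)
open import Data.Nat.Base as ℕ using (ℕ; zero; suc; _^_; _%_; _/_; NonZero; z≤n; s≤s)
import Data.Nat.Coprimality as Coprime
open import Data.Nat.Divisibility using (_∣_; _∣?_; divides; ∣m∣n⇒∣m+n; ∣m+n∣m⇒∣n; m%n≡0⇒n∣m; n∣m⇒m%n≡0)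
open import Data.Nat.DivMod using (_mod_; m%n<n; m≡m%n+[m/n]*n; %-distribˡ-+; m<n*o⇒m/o<n; m*n/n≡m)
import Data.Nat.Properties as ℕ
open import Data.Nat.Solver using (module +-*-Solver)
open import Data.Product.Base using (∃; ∃-syntax; ∃₂; _×_; _,_; proj₁; proj₂)
open import Data.Rational.Base as ℚ using (ℚ; mkℚ; 0ℚ; 1ℚ; ∣_∣)
import Data.Rational.Properties as ℚ
import Data.Rational.Solver as ℚSolver
import Data.Rational.Unnormalised.Base as ℚᵘ
import Data.Rational.Unnormalised.Properties as ℚᵘ
open import Data.Sum.Base using (_⊎_; inj₁; inj₂; [_,_]′)
open import Data.Vec.Functional using () renaming (_∷_ to _∷ᵛ_)
open import Function.Base using (_∘_)
open import Level using (Level; 0ℓ; _⊔_) renaming (suc to lsuc)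
open import Relation.Binary.Definitions using (tri<; tri≈; tri>)
open import Relation.Binary.PropositionalEquality as ≡ using (_≡_; _≢_; refl; sym; trans; cong; cong₂; subst; subst₂)
import Relation.Binary.Reasoning.Setoid as SetoidReasoning
open import Relation.Nullary.Decidable.Core using (Dec; yes; no; _×-dec_; _⊎-dec_; decidable-stable)
open import Relation.Nullary.Negation.Core using (¬_)

-- The Cauchy reals form an Archimedean ordered ring

-- The threshold 2 q_{n+1} is what makes halving work: half of a difference of two denominators
-- below it is a denominator below q_{n+1}, where no error is shorter than that of q_n. If σ is the
-- squared error of q_n, such a difference of errors has squared length at least 4σ, while every
-- error in the window has squared length at most σ. Parity of the denominator doubles the number of
-- classes, giving 2^(d+1) = 2M in all, of which T fills M.
--
-- The reals are Cauchy sequences, so neither their order nor membership in 2L can be decided. Hence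
-- `≤` is a negated `<`, and the coordinates modulo 2L, and with them the involution, exist only
-- under a double negation. It is removed at the end because the required pairing is one of finitely
-- many and is tested by equations in `ℕ`.
--
-- No lattice basis is constructed. That L/2L has rank at most d is seen directly: among more than d
-- lattice vectors two different combinations with bounded coefficients coincide, and halving this
-- relation as long as possible leaves one with an odd coefficient.

record ArchimedeanOrderedRing : Set₁ where
  field
    commutativeRing : CommutativeRing 0ℓ 0ℓ
  open CommutativeRing commutativeRing public hiding (trans; sym; refl; zero)
  open CommutativeRing commutativeRing public using () renaming
      (trans to ≈-trans; sym to ≈-sym; refl to ≈-refl)
  open MonoidMult +-monoid public using () renaming (_×_ to _×ᴿ_)
  infix 4 _<_
  field
    _<_         : Carrier → Carrier → Set
    <-irrefl    : ∀ {x y} → x ≈ y → ¬ x < y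
    <-trans     : ∀ {x y z} → x < y → y < z → x < z
    <-cotrans   : ∀ {x y} → x < y → ∀ z → x < z ⊎ z < y
    tight       : ∀ {x y} → ¬ x < y → ¬ y < x → x ≈ y
    +-monoˡ-<   : ∀ {x y} z → x < y → x + z < y + z
    *-pos       : ∀ {x y} → 0# < x → 0# < y → 0# < x * y
    0<1         : 0# < 1#
    archimedean : ∀ x {y} → 0# < y → ∃[ n ] x < n ×ᴿ y

module RationalLemmas where
  open ℚSolver.+-*-Solver

  -- Turns a linear inequality into a polynomial identity that the ring solver can check.
  ≤-by-difference : ∀ {a b x y} → a ℚ.≤ b → y ℚ.- x ≡ b ℚ.- a → x ℚ.≤ y
  ≤-by-difference {a} {b} {x} {y} a≤b eq =
    subst₂ ℚ._≤_
      (solve 2 (λ a x → a :+ (x :- a) := x) refl a x)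
      (trans (solve 3 (λ a b x → b :+ (x :- a) := (b :- a) :+ x) refl a b x)
        (trans (cong (ℚ._+ x) (sym eq)) (solve 2 (λ x y → (y :- x) :+ x := y) refl x y)))
      (ℚ.+-monoˡ-≤ (x ℚ.- a) a≤b)

  <-by-difference : ∀ {a b x y} → a ℚ.< b → y ℚ.- x ≡ b ℚ.- a → x ℚ.< y
  <-by-difference {a} {b} {x} {y} a<b eq =
    subst₂ ℚ._<_
      (solve 2 (λ a x → a :+ (x :- a) := x) refl a x)
      (trans (solve 3 (λ a b x → b :+ (x :- a) := (b :- a) :+ x) refl a b x)
        (trans (cong (ℚ._+ x) (sym eq)) (solve 2 (λ x y → (y :- x) :+ x := y) refl x y)))
      (ℚ.+-monoˡ-< (x ℚ.- a) a<b)

  p≤∣p∣ : ∀ p → p ℚ.≤ ∣ p ∣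
  p≤∣p∣ p with ℚ.≤-total 0ℚ p
  ... | inj₁ 0≤p = ℚ.≤-reflexive (sym (ℚ.0≤p⇒∣p∣≡p 0≤p))
  ... | inj₂ p≤0 = ℚ.≤-trans p≤0 (ℚ.0≤∣p∣ p)

  ∣∣-< : ∀ {p ε} → p ℚ.< ε → ℚ.- p ℚ.< ε → ∣ p ∣ ℚ.< ε
  ∣∣-< {p} {ε} p<ε -p<ε with ℚ.∣p∣≡p∨∣p∣≡-p p
  ... | inj₁ eq = subst (ℚ._< ε) (sym eq) p<ε
  ... | inj₂ eq = subst (ℚ._< ε) (sym eq) -p<ε

  ∣-∣⇒< : ∀ a b {ε} → ∣ a ℚ.- b ∣ ℚ.< ε → a ℚ.< b ℚ.+ ε
  ∣-∣⇒< a b {ε} h = <-by-difference (ℚ.≤-<-trans (p≤∣p∣ (a ℚ.- b)) h)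
    (solve 3 (λ a b e → (b :+ e) :- a := e :- (a :- b)) refl a b ε)

  *-pos-ℚ : ∀ {a b} → 0ℚ ℚ.< a → 0ℚ ℚ.< b → 0ℚ ℚ.< a ℚ.* b
  *-pos-ℚ {a} {b} 0<a 0<b =
    subst (ℚ._< a ℚ.* b) (ℚ.*-zeroˡ b) (ℚ.*-monoˡ-<-pos b {{ℚ.positive 0<b}} 0<a)

  *-mono-≤-ℚ : ∀ {a b c d} → 0ℚ ℚ.≤ a → 0ℚ ℚ.≤ d → a ℚ.≤ b → c ℚ.≤ d → a ℚ.* c ℚ.≤ b ℚ.* d
  *-mono-≤-ℚ {a} {b} {c} {d} 0≤a 0≤d a≤b c≤d = ℚ.≤-trans
    (ℚ.*-monoˡ-≤-nonNeg a {{ℚ.nonNegative 0≤a}} c≤d)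
    (ℚ.*-monoʳ-≤-nonNeg d {{ℚ.nonNegative 0≤d}} a≤b)

  ι : ℕ → ℚ
  ι n = mkℚ (+ n) 0 (Coprime.sym (Coprime.1-coprimeTo n))

  ι-suc : ∀ n → ι (suc n) ≡ 1ℚ ℚ.+ ι n
  ι-suc n = ℚ.toℚᵘ-injective (ℚᵘ.≃-sym (ℚᵘ.≃-trans (ℚ.toℚᵘ-homo-+ 1ℚ (ι n))
    (ℚᵘ.*≡* (I.solve 1 (λ n → (I.con (+ 1) I.:* I.con (+ 1) I.:+ n I.:* I.con (+ 1)) I.:* I.con
        (+ 1) I.:= (I.con (+ 1) I.:+ n) I.:* (I.con (+ 1) I.:* I.con (+ 1))) refl (+ n)))))
    where module I = ℤSolver.+-*-Solver

  <ι : ∀ p → ∃[ n ] p ℚ.< ι n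
  <ι p@(mkℚ (+ k) d-1 _) = suc k , ℚ.*<* (subst₂ ℤ._<_ (sym (ℤ.*-identityʳ (+ k))) refl
    (ℤ.+<+ (ℕ.<-≤-trans (ℕ.n<1+n k) (ℕ.m≤m*n (suc k) (suc d-1)))))
  <ι p@(mkℚ (-[1+ k ]) d-1 _) = 0 , ℚ.*<* (subst₂ ℤ._<_ (sym (ℤ.*-identityʳ (-[1+ k ]))) refl ℤ.-<+)

  archimedean-ℚ : ∀ p {ε} → 0ℚ ℚ.< ε → ∃[ n ] p ℚ.≤ ι n ℚ.* ε
  archimedean-ℚ p {ε} 0<ε =
    let n , h = <ι (p ℚ.* ℚ.1/ ε)
    in n , subst (ℚ._≤ ι n ℚ.* ε)
      (trans (ℚ.*-assoc p (ℚ.1/ ε) ε) (trans (cong (p ℚ.*_) (ℚ.*-inverseˡ ε)) (ℚ.*-identityʳ p)))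
      (ℚ.<⇒≤ (ℚ.*-monoˡ-<-pos ε h))
    where
    instance
      posε = ℚ.positive 0<ε
      nzε = ℚ.pos⇒nonZero ε

module RealOrder where
  open RationalLemmas
  open CauchyLemmas
  open ℝ-Laws
  open ℚSolver.+-*-Solver

  fraction-pos : ∀ c {ε} → {{ℚ.Positive c}} → 0ℚ ℚ.< ε → 0ℚ ℚ.< c ℚ.* ε
  fraction-pos c 0<ε = *-pos-ℚ (ℚ.positive⁻¹ c) 0<ε

  <-irreflᴿ : ∀ {x y} → x ≈ᴿ y → ¬ x <ᴿ y
  <-irreflᴿ {x} {y} x≈y (ε , 0<ε , N , h) =
    let M , g = ≈-sym {x} {y} x≈y ε 0<ε
        n = M ℕ.⊔ N
    in ℚ.<-irrefl refl (ℚ.<-≤-trans (∣-∣⇒< (seq y n) (seq x n) {ε} (g n (ℕ.m≤m⊔n M N)))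
          (h n (ℕ.m≤n⊔m M N)))

  <-transᴿ : ∀ {x y z} → x <ᴿ y → y <ᴿ z → x <ᴿ z
  <-transᴿ {x} {y} {z} (ε , 0<ε , N , h) (δ , 0<δ , M , g) = ε , 0<ε , N ℕ.⊔ M , λ n le →
    ℚ.≤-trans (h n (⊔ˡ-≤ le))
      (ℚ.≤-trans (subst (ℚ._≤ seq y n ℚ.+ δ) (ℚ.+-identityʳ (seq y n))
          (ℚ.+-monoʳ-≤ (seq y n) (ℚ.<⇒≤ 0<δ)))
        (g n (⊔ʳ-≤ {N} le)))

  -- Of the gap 3η at stage `N`, one η is lost to the later movement of x and one to that of y; the
  -- third is the uniform gap demanded by `<ᴿ`.
  <-from-approximation : ∀ {x y : ℝ} {η} N → 0ℚ ℚ.< η →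
    (∀ m n → N ℕ.≤ m → N ℕ.≤ n → ∣ seq x m ℚ.- seq x n ∣ ℚ.< η) →
    (∀ m n → N ℕ.≤ m → N ℕ.≤ n → ∣ seq y m ℚ.- seq y n ∣ ℚ.< η) →
    seq x N ℚ.+ (η ℚ.+ η ℚ.+ η) ℚ.≤ seq y N → x <ᴿ y
  <-from-approximation {x} {y} {η} N 0<η cx cy gap = η , 0<η , N , λ n N≤n →
    ≤-by-difference
      (ℚ.+-mono-≤ (ℚ.+-mono-≤ (ℚ.<⇒≤ (∣-∣⇒< (seq x n) (seq x N) (cx n N N≤n ℕ.≤-refl)))
          (ℚ.<⇒≤ (∣-∣⇒< (seq y N) (seq y n) (cy N n ℕ.≤-refl N≤n)))) gap)
      (solve 5 (λ a b c d e → d :- (a :+ e) := ((b :+ e) :+ (d :+ e) :+ c) :-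
          (a :+ c :+ (b :+ (e :+ e :+ e)))) refl
        (seq x n) (seq x N) (seq y N) (seq y n) η)

  <-cotransᴿ : ∀ {x y} → x <ᴿ y → ∀ z → x <ᴿ z ⊎ z <ᴿ y
  <-cotransᴿ {x} {y} (ε , 0<ε , N , h) z = compare
    where
    -- Half of the gap ε is 3η, the amount needed by `<-from-approximation`: at stage `K`, either z
    -- is at least 3η above x or it is at least 3η below y.
    η = (+ 1 ℚ./ 6) ℚ.* ε
    0<η = fraction-pos (+ 1 ℚ./ 6) 0<ε
    X = cauchy x η 0<η
    Y = cauchy y η 0<η
    Z = cauchy z η 0<η
    K = N ℕ.⊔ (proj₁ X ℕ.⊔ (proj₁ Y ℕ.⊔ proj₁ Z))
    K≤ : ∀ {n} → K ℕ.≤ n → proj₁ X ℕ.⊔ (proj₁ Y ℕ.⊔ proj₁ Z) ℕ.≤ n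
    K≤ = ⊔ʳ-≤ {N}
    cx : ∀ m n → K ℕ.≤ m → K ℕ.≤ n → ∣ seq x m ℚ.- seq x n ∣ ℚ.< η
    cx m n p q = proj₂ X m n (⊔ˡ-≤ (K≤ p)) (⊔ˡ-≤ (K≤ q))
    cy : ∀ m n → K ℕ.≤ m → K ℕ.≤ n → ∣ seq y m ℚ.- seq y n ∣ ℚ.< η
    cy m n p q = proj₂ Y m n (⊔ˡ-≤ (⊔ʳ-≤ {proj₁ X} (K≤ p))) (⊔ˡ-≤ (⊔ʳ-≤ {proj₁ X} (K≤ q)))
    cz : ∀ m n → K ℕ.≤ m → K ℕ.≤ n → ∣ seq z m ℚ.- seq z n ∣ ℚ.< η
    cz m n p q = proj₂ Z m n (⊔ʳ-≤ {proj₁ Y} (⊔ʳ-≤ {proj₁ X} (K≤ p)))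
        (⊔ʳ-≤ {proj₁ Y} (⊔ʳ-≤ {proj₁ X} (K≤ q)))
    compare : x <ᴿ z ⊎ z <ᴿ y
    compare with (seq x K ℚ.+ (η ℚ.+ η ℚ.+ η)) ℚ.≤? seq z K
    ... | yes p = inj₁ (<-from-approximation {x} {z} K 0<η cx cz p)
    ... | no ¬p = inj₂ (<-from-approximation {z} {y} K 0<η cz cy
      (≤-by-difference (ℚ.+-mono-≤ (ℚ.<⇒≤ (ℚ.≰⇒> ¬p)) (h K (ℕ.m≤m⊔n N _)))
        (solve 4 (λ a b c e → let t = con (+ 1 ℚ./ 6) :* e in
          b :- (c :+ (t :+ t :+ t)) := ((a :+ (t :+ t :+ t)) :+ b) :- (c :+ (a :+ e))) refl
          (seq x K) (seq y K) (seq z K) ε)))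

  tightᴿ : ∀ {x y} → ¬ x <ᴿ y → ¬ y <ᴿ x → x ≈ᴿ y
  tightᴿ {x} {y} x≮y y≮x ε 0<ε = K , λ n K≤n → ∣∣-<
      (<-by-difference
        (ℚ.+-mono-< (ℚ.+-mono-< (∣-∣⇒< (seq x n) (seq x K) (cx n K K≤n ℕ.≤-refl))
            (∣-∣⇒< (seq y K) (seq y n) (cy K n ℕ.≤-refl K≤n))) xK<)
        (solve 5 (λ a b c d e → let t = con (+ 1 ℚ./ 5) :* e in
          e :- (a :- d) := ((b :+ t) :+ (d :+ t) :+ (c :+ (t :+ t :+ t))) :- (a :+ c :+ b)) refl
          (seq x n) (seq x K) (seq y K) (seq y n) ε))
      (<-by-difference
        (ℚ.+-mono-< (ℚ.+-mono-< (∣-∣⇒< (seq y n) (seq y K) (cy n K K≤n ℕ.≤-refl))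
            (∣-∣⇒< (seq x K) (seq x n) (cx K n ℕ.≤-refl K≤n))) yK<)
        (solve 5 (λ a b c d e → let t = con (+ 1 ℚ./ 5) :* e in
          e :- (:- (d :- a)) := ((b :+ t) :+ (d :+ t) :+ (c :+ (t :+ t :+ t))) :- (a :+ c :+ b))
              refl
          (seq y n) (seq y K) (seq x K) (seq x n) ε))
    where
    -- At stage `K` the sequences differ by less than 3η, and from then on each moves by less than
    -- η, in total 5η = ε.
    η = (+ 1 ℚ./ 5) ℚ.* ε
    0<η = fraction-pos (+ 1 ℚ./ 5) 0<ε
    X = cauchy x η 0<η
    Y = cauchy y η 0<η
    K = proj₁ X ℕ.⊔ proj₁ Y
    cx : ∀ m n → K ℕ.≤ m → K ℕ.≤ n → ∣ seq x m ℚ.- seq x n ∣ ℚ.< η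
    cx m n p q = proj₂ X m n (⊔ˡ-≤ p) (⊔ˡ-≤ q)
    cy : ∀ m n → K ℕ.≤ m → K ℕ.≤ n → ∣ seq y m ℚ.- seq y n ∣ ℚ.< η
    cy m n p q = proj₂ Y m n (⊔ʳ-≤ {proj₁ X} p) (⊔ʳ-≤ {proj₁ X} q)
    xK< : seq x K ℚ.< seq y K ℚ.+ (η ℚ.+ η ℚ.+ η)
    xK< = ℚ.≰⇒> λ p → y≮x (<-from-approximation {y} {x} K 0<η cy cx p)
    yK< : seq y K ℚ.< seq x K ℚ.+ (η ℚ.+ η ℚ.+ η)
    yK< = ℚ.≰⇒> λ p → x≮y (<-from-approximation {x} {y} K 0<η cx cy p)

  +-monoˡ-<ᴿ : ∀ {x y} z → x <ᴿ y → x +ᴿ z <ᴿ y +ᴿ z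
  +-monoˡ-<ᴿ {x} {y} z (ε , 0<ε , N , h) = ε , 0<ε , N , λ n N≤n →
    ≤-by-difference (h n N≤n)
      (solve 4 (λ a b c e → (b :+ c) :- (a :+ c :+ e) := b :- (a :+ e)) refl (seq x n) (seq y n)
          (seq z n) ε)

  *-posᴿ : ∀ {x y} → 0ᴿ <ᴿ x → 0ᴿ <ᴿ y → 0ᴿ <ᴿ x *ᴿ y
  *-posᴿ {x} {y} (ε , 0<ε , N , h) (δ , 0<δ , M , g) = ε ℚ.* δ , *-pos-ℚ 0<ε 0<δ , N ℕ.⊔ M ,
      λ n le →
    let ε≤x = subst (ℚ._≤ seq x n) (ℚ.+-identityˡ ε) (h n (⊔ˡ-≤ le))
        δ≤y = subst (ℚ._≤ seq y n) (ℚ.+-identityˡ δ) (g n (⊔ʳ-≤ {N} le))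
    in subst (ℚ._≤ seq x n ℚ.* seq y n) (sym (ℚ.+-identityˡ (ε ℚ.* δ)))
         (*-mono-≤-ℚ (ℚ.<⇒≤ 0<ε) (ℚ.≤-trans (ℚ.<⇒≤ 0<δ) δ≤y) ε≤x δ≤y)

  0<1ᴿ : 0ᴿ <ᴿ 1ᴿ
  0<1ᴿ = 1ℚ , ℚ.positive⁻¹ 1ℚ , 0 , λ n _ → ℚ.≤-refl

  open MonoidMult (CommutativeRing.+-monoid ℝ-commutativeRing) using () renaming (_×_ to _×ᴿ_)

  ι*≤× : ∀ m (y : ℝ) {ε} n → ε ℚ.≤ seq y n → ι m ℚ.* ε ℚ.≤ seq (m ×ᴿ y) n
  ι*≤× zero y {ε} n ε≤y = ℚ.≤-reflexive (ℚ.*-zeroˡ ε)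
  ι*≤× (suc m) y {ε} n ε≤y = subst (ℚ._≤ seq y n ℚ.+ seq (m ×ᴿ y) n)
    (sym (trans (cong (ℚ._* ε) (ι-suc m)) (solve 2 (λ m e → (con 1ℚ :+ m) :* e := e :+ m :* e) refl
        (ι m) ε)))
    (ℚ.+-mono-≤ ε≤y (ι*≤× m y n ε≤y))

  archimedeanᴿ : ∀ x {y} → 0ᴿ <ᴿ y → ∃[ n ] x <ᴿ (n ×ᴿ y)
  archimedeanᴿ x {y} (ε , 0<ε , N , h) =
    let B , _ , M , g = bound (seq x) (cauchy x)
        -- The summand ε beyond the bound B becomes the gap in `<ᴿ`.
        m , B+ε≤ = archimedean-ℚ (B ℚ.+ ε) 0<ε
    in m , ε , 0<ε , N ℕ.⊔ M , λ n le →
      ℚ.≤-trans (ℚ.+-monoˡ-≤ ε (ℚ.≤-trans (p≤∣p∣ (seq x n)) (ℚ.<⇒≤ (g n (⊔ʳ-≤ {N} le)))))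
        (ℚ.≤-trans B+ε≤ (ι*≤× m y n (subst (ℚ._≤ seq y n) (ℚ.+-identityˡ ε) (h n (⊔ˡ-≤ le)))))

ℝ-archimedean : ArchimedeanOrderedRing
ℝ-archimedean = record
  { commutativeRing = ℝ-commutativeRing
  ; _<_ = _<ᴿ_
  ; <-irrefl = λ {x} {y} → <-irreflᴿ {x} {y}
  ; <-trans = λ {x} {y} {z} → <-transᴿ {x} {y} {z}
  ; <-cotrans = λ {x} {y} → <-cotransᴿ {x} {y}
  ; tight = λ {x} {y} → tightᴿ {x} {y}
  ; +-monoˡ-< = λ {x} {y} → +-monoˡ-<ᴿ {x} {y}
  ; *-pos = λ {x} {y} → *-posᴿ {x} {y}
  ; 0<1 = 0<1ᴿ
  ; archimedean = λ x {y} → archimedeanᴿ x {y}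
  }
  where open RealOrder

-- Ordered rings

module OrderedRing (A : ArchimedeanOrderedRing) where
  open ArchimedeanOrderedRing A public
  open MonoidMult +-monoid using (×-homo-+)
  module S = SemiringSolver commutativeSemiring

  infix 4 _≤_
  _≤_ : Carrier → Carrier → Set
  x ≤ y = ¬ y < x

  -- Compatibility of `<` with `≈` follows from cotransitivity: comparing with the third element
  -- leaves an unwanted case that irreflexivity excludes.
  <-respʳ : ∀ {x y z} → y ≈ z → x < y → x < z
  <-respʳ {z = z} y≈z x<y with <-cotrans x<y z
  ... | inj₁ x<z = x<z
  ... | inj₂ z<y = ⊥-elim (<-irrefl (≈-sym y≈z) z<y)

  <-respˡ : ∀ {x y z} → x ≈ y → x < z → y < z
  <-respˡ {y = y} x≈y x<z with <-cotrans x<z y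
  ... | inj₁ x<y = ⊥-elim (<-irrefl x≈y x<y)
  ... | inj₂ y<z = y<z

  <-resp : ∀ {x y x′ y′} → x ≈ x′ → y ≈ y′ → x < y → x′ < y′
  <-resp p q x<y = <-respˡ p (<-respʳ q x<y)

  ≤-reflexive : ∀ {x y} → x ≈ y → x ≤ y
  ≤-reflexive x≈y y<x = <-irrefl (≈-sym x≈y) y<x

  ≤-refl : ∀ {x} → x ≤ x
  ≤-refl = ≤-reflexive ≈-refl

  ≤-<-trans : ∀ {x y z} → x ≤ y → y < z → x < z
  ≤-<-trans {x} x≤y y<z with <-cotrans y<z x
  ... | inj₁ y<x = ⊥-elim (x≤y y<x)
  ... | inj₂ x<z = x<z

  <-≤-trans : ∀ {x y z} → x < y → y ≤ z → x < z
  <-≤-trans {z = z} x<y y≤z with <-cotrans x<y z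
  ... | inj₁ x<z = x<z
  ... | inj₂ z<y = ⊥-elim (y≤z z<y)

  ≤-trans : ∀ {x y z} → x ≤ y → y ≤ z → x ≤ z
  ≤-trans x≤y y≤z z<x = x≤y (≤-<-trans y≤z z<x)

  <⇒≤ : ∀ {x y} → x < y → x ≤ y
  <⇒≤ x<y y<x = <-irrefl ≈-refl (<-trans x<y y<x)

  ≤-resp : ∀ {x y x′ y′} → x ≈ x′ → y ≈ y′ → x ≤ y → x′ ≤ y′
  ≤-resp p q x≤y y′<x′ = x≤y (<-resp (≈-sym q) (≈-sym p) y′<x′)

  +-monoʳ-< : ∀ {x y} z → x < y → z + x < z + y
  +-monoʳ-< z x<y = <-resp (+-comm _ z) (+-comm _ z) (+-monoˡ-< z x<y)

  +-cancelʳ-< : ∀ {x y} z → x + z < y + z → x < y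
  +-cancelʳ-< {x} {y} z h = <-resp (cancel x) (cancel y) (+-monoˡ-< (- z) h)
    where
    cancel : ∀ x → x + z + - z ≈ x
    cancel x = ≈-trans (+-assoc x z (- z)) (≈-trans (+-congˡ (-‿inverseʳ z)) (+-identityʳ x))

  +-monoˡ-≤ : ∀ {x y} z → x ≤ y → x + z ≤ y + z
  +-monoˡ-≤ z x≤y h = x≤y (+-cancelʳ-< z h)

  +-monoʳ-≤ : ∀ {x y} z → x ≤ y → z + x ≤ z + y
  +-monoʳ-≤ z x≤y = ≤-resp (+-comm _ z) (+-comm _ z) (+-monoˡ-≤ z x≤y)

  +-mono-≤ : ∀ {x y u v} → x ≤ y → u ≤ v → x + u ≤ y + v
  +-mono-≤ {y = y} {u} x≤y u≤v = ≤-trans (+-monoˡ-≤ u x≤y) (+-monoʳ-≤ y u≤v)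

  +-mono-<-≤ : ∀ {x y u v} → x < y → u ≤ v → x + u < y + v
  +-mono-<-≤ {y = y} {u} x<y u≤v = <-≤-trans (+-monoˡ-< u x<y) (+-monoʳ-≤ y u≤v)

  +-mono-< : ∀ {x y u v} → x < y → u < v → x + u < y + v
  +-mono-< x<y u<v = +-mono-<-≤ x<y (<⇒≤ u<v)

  +-nonNeg : ∀ {x y} → 0# ≤ x → 0# ≤ y → 0# ≤ x + y
  +-nonNeg 0≤x 0≤y = ≤-resp (+-identityˡ 0#) ≈-refl (+-mono-≤ 0≤x 0≤y)

  x≤x+nonNeg : ∀ {x y} → 0# ≤ y → x ≤ x + y
  x≤x+nonNeg {x} 0≤y = ≤-resp (+-identityʳ x) ≈-refl (+-monoʳ-≤ x 0≤y)

  0≤y-x : ∀ {x y} → x ≤ y → 0# ≤ y + - x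
  0≤y-x {x} x≤y = ≤-resp (-‿inverseʳ x) ≈-refl (+-monoˡ-≤ (- x) x≤y)

  y-x+x≈y : ∀ x y → y + - x + x ≈ y
  y-x+x≈y x y = ≈-trans (+-assoc y (- x) x) (≈-trans (+-congˡ (-‿inverseˡ x)) (+-identityʳ y))

  -- The goal is a negation, so positivity of both factors may be assumed up to double negation; a
  -- nonnegative factor that is not positive is 0 by tightness.
  *-nonNeg : ∀ {x y} → 0# ≤ x → 0# ≤ y → 0# ≤ x * y
  *-nonNeg {x} {y} 0≤x 0≤y xy<0 =
    ¬0≮x λ 0<x → ¬0≮y λ 0<y → <-irrefl ≈-refl (<-trans xy<0 (*-pos 0<x 0<y))
    where
    ¬0≮x : ¬ ¬ 0# < x
    ¬0≮x 0≮x = <-irrefl (≈-trans (*-congʳ (tight 0≤x 0≮x)) (zeroˡ y)) xy<0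
    ¬0≮y : ¬ ¬ 0# < y
    ¬0≮y 0≮y = <-irrefl (≈-trans (*-congˡ (tight 0≤y 0≮y)) (zeroʳ x)) xy<0

  *-monoʳ-≤ : ∀ {x y z} → 0# ≤ z → x ≤ y → x * z ≤ y * z
  *-monoʳ-≤ {x} {y} {z} 0≤z x≤y = ≤-resp (+-identityˡ (x * z))
    (≈-trans (≈-sym (distribʳ z (y + - x) x)) (*-congʳ (y-x+x≈y x y)))
    (+-monoˡ-≤ (x * z) (*-nonNeg (0≤y-x x≤y) 0≤z))

  *-monoʳ-< : ∀ {x y z} → 0# < z → x < y → x * z < y * z
  *-monoʳ-< {x} {y} {z} 0<z x<y = <-resp (+-identityˡ (x * z))
    (≈-trans (≈-sym (distribʳ z (y + - x) x)) (*-congʳ (y-x+x≈y x y)))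
    (+-monoˡ-< (x * z) (*-pos (<-respˡ (-‿inverseʳ x) (+-monoˡ-< (- x) x<y)) 0<z))

  square-mono-≤ : ∀ {x y} → 0# ≤ x → x ≤ y → x * x ≤ y * y
  square-mono-≤ {x} {y} 0≤x x≤y = ≤-trans (*-monoʳ-≤ 0≤x x≤y)
    (≤-resp (*-comm x y) ≈-refl (*-monoʳ-≤ (≤-trans 0≤x x≤y) x≤y))

  square-mono-< : ∀ {x y} → 0# ≤ x → x < y → x * x < y * y
  square-mono-< {x} {y} 0≤x x<y = ≤-<-trans (*-monoʳ-≤ 0≤x (<⇒≤ x<y))
    (<-respˡ (*-comm x y) (*-monoʳ-< (≤-<-trans 0≤x x<y) x<y))

  -- c² - s² = (c - s)(s + c) is a product of nonnegative factors. The two hypotheses replace an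
  -- absolute value.
  square-bound : ∀ {s c} → s ≤ c → - s ≤ c → s * s ≤ c * c
  square-bound {s} {c} s≤c -s≤c = ≤-resp (+-identityʳ (s * s)) identity
    (+-monoʳ-≤ (s * s) (*-nonNeg (0≤y-x s≤c)
      (≤-resp (-‿inverseˡ s) (+-comm c s) (+-monoˡ-≤ s -s≤c))))
    where
    open SetoidReasoning setoid
    identity : s * s + (c + - s) * (s + c) ≈ c * c
    identity = begin
      s * s + (c + - s) * (s + c)
        ≈⟨ S.solve 3 (λ s t c → s S.:* s S.:+ t S.:* (s S.:+ c) S.:= (t S.:+ s) S.:* s S.:+ t S.:*
            c) ≈-refl s (c + - s) c ⟩
      (c + - s + s) * s + (c + - s) * c ≈⟨ +-congʳ (*-congʳ (y-x+x≈y s c)) ⟩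
      c * s + (c + - s) * c
        ≈⟨ S.solve 3 (λ s t c → c S.:* s S.:+ t S.:* c S.:= (t S.:+ s) S.:* c) ≈-refl s
            (c + - s) c ⟩
      (c + - s + s) * c ≈⟨ *-congʳ (y-x+x≈y s c) ⟩
      c * c ∎

  ×-congˡ : ∀ {m n x} → m ≡ n → m ×ᴿ x ≈ n ×ᴿ x
  ×-congˡ refl = ≈-refl

  -‿anti-homo-- : ∀ x y → - (x + - y) ≈ y + - x
  -‿anti-homo-- = AbelianGroupProperties.⁻¹-anti-homo‿- +-abelianGroup

  ×-distrib-- : ∀ n x y → n ×ᴿ (x + - y) ≈ n ×ᴿ x + - (n ×ᴿ y)
  ×-distrib-- n x y = ≈-trans
      (≈-sym (≈-trans (+-assoc _ _ _) (≈-trans (+-congˡ (-‿inverseʳ (n ×ᴿ y))) (+-identityʳ _))))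
    (+-congʳ (≈-trans (≈-sym (CommutativeMonoidMult.×-distrib-+ +-commutativeMonoid (x + - y) y n))
      (CommutativeMonoidMult.×-congʳ +-commutativeMonoid n (y-x+x≈y y x))))

  ×-mono-≤ : ∀ n {x y} → x ≤ y → n ×ᴿ x ≤ n ×ᴿ y
  ×-mono-≤ zero    x≤y = ≤-refl
  ×-mono-≤ (suc n) x≤y = +-mono-≤ x≤y (×-mono-≤ n x≤y)

  ×-nonNeg : ∀ n {x} → 0# ≤ x → 0# ≤ n ×ᴿ x
  ×-nonNeg zero    0≤x = ≤-refl
  ×-nonNeg (suc n) 0≤x = +-nonNeg 0≤x (×-nonNeg n 0≤x)

  ×-monoˡ-≤ : ∀ {m n x} → 0# ≤ x → m ℕ.≤ n → m ×ᴿ x ≤ n ×ᴿ x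
  ×-monoˡ-≤ {n = n} 0≤x ℕ.z≤n = ×-nonNeg n 0≤x
  ×-monoˡ-≤ {x = x} 0≤x (ℕ.s≤s m≤n) = +-monoʳ-≤ x (×-monoˡ-≤ 0≤x m≤n)

  0≤1 : 0# ≤ 1#
  0≤1 = <⇒≤ 0<1

  infix 4 ∣_∣≤_
  -- The lower bound is written without negation, in the form that the semiring solver `S` accepts.
  record ∣_∣≤_ (x : Carrier) (c : ℕ) : Set where
    field
      upper : x ≤ c ×ᴿ 1#
      lower : 0# ≤ x + c ×ᴿ 1#
  open ∣_∣≤_ public

  ∣∣≤-+ : ∀ {x y a b} → ∣ x ∣≤ a → ∣ y ∣≤ b → ∣ x + y ∣≤ a ℕ.+ b
  ∣∣≤-+ {x} {y} {a} {b} p q = record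
    { upper = ≤-resp ≈-refl (≈-sym (×-homo-+ 1# a b)) (+-mono-≤ (upper p) (upper q))
    ; lower = ≤-resp ≈-refl
        (≈-trans (S.solve 4 (λ x y a b → (x S.:+ a) S.:+ (y S.:+ b) S.:= (x S.:+ y) S.:+ (a S.:+ b))
            ≈-refl x y (a ×ᴿ 1#) (b ×ᴿ 1#))
          (+-congˡ (≈-sym (×-homo-+ 1# a b))))
        (+-nonNeg (lower p) (lower q))
    }

  ∣∣≤-0 : ∀ c → ∣ 0# ∣≤ c
  ∣∣≤-0 c = record { upper = ×-nonNeg c 0≤1 ; lower = +-nonNeg ≤-refl (×-nonNeg c 0≤1) }

  ∣∣≤-mono : ∀ {x a b} → a ℕ.≤ b → ∣ x ∣≤ a → ∣ x ∣≤ b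
  ∣∣≤-mono {x} a≤b p = record
    { upper = ≤-trans (upper p) (×-monoˡ-≤ 0≤1 a≤b)
    ; lower = ≤-trans (lower p) (+-monoʳ-≤ x (×-monoˡ-≤ 0≤1 a≤b))
    }

  ∣∣≤-× : ∀ n {x c} → ∣ x ∣≤ c → ∣ n ×ᴿ x ∣≤ n ℕ.* c
  ∣∣≤-× zero    p = ∣∣≤-0 0
  ∣∣≤-× (suc n) p = ∣∣≤-+ p (∣∣≤-× n p)

  bounded : ∀ x → ∃[ c ] ∣ x ∣≤ c
  bounded x =
    let m , x<m = archimedean x 0<1
        n , -x<n = archimedean (- x) 0<1
    in m ℕ.+ n , record
      { upper = ≤-trans (<⇒≤ x<m) (×-monoˡ-≤ 0≤1 (ℕ.m≤m+n m n))
      ; lower = ≤-trans (≤-resp (-‿inverseʳ x) ≈-refl (+-monoʳ-≤ x (<⇒≤ -x<n)))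
          (+-monoʳ-≤ x (×-monoˡ-≤ 0≤1 (ℕ.m≤n+m n m)))
      }

  -- Comparison with integers is only decidable up to overlap, so the cells are the intervals (k, k+2).
  locate : ∀ c {y} → 0# < y → y < c ×ᴿ 1# + (1# + 1#) →
    ∃[ k ] (k ℕ.≤ c × k ×ᴿ 1# < y × y < k ×ᴿ 1# + (1# + 1#))
  locate zero    0<y y<2 = 0 , ℕ.z≤n , 0<y , y<2
  locate (suc c) {y} 0<y y<c with <-cotrans (<-resp (+-identityʳ _)
      (S.solve 1 (λ c → (S.con 1 S.:+ c) S.:+ S.con 1 S.:= c S.:+ (S.con 1 S.:+ S.con 1)) ≈-refl
          (c ×ᴿ 1#)) (+-monoʳ-< (suc c ×ᴿ 1#) 0<1)) y
  ... | inj₁ c<y = suc c , ℕ.≤-refl , c<y , y<c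
  ... | inj₂ y<c+2 = let k , k≤c , h = locate c 0<y y<c+2 in k , ℕ.m≤n⇒m≤1+n k≤c , h

  -- The shift is by `suc c` rather than `c` because `locate` needs a strictly positive argument.
  locate-∣∣≤ : ∀ c {y} → ∣ y ∣≤ c →
    ∃[ k ] (k ℕ.≤ c ℕ.+ c × k ×ᴿ 1# < y + suc c ×ᴿ 1# × y + suc c ×ᴿ 1# < k ×ᴿ 1# + (1# + 1#))
  locate-∣∣≤ c {y} y≤c = locate (c ℕ.+ c)
    (<-resp (+-identityˡ 0#) (S.solve 2 (λ y c → (y S.:+ c) S.:+ S.con 1 S.:= y S.:+
        (S.con 1 S.:+ c)) ≈-refl y (c ×ᴿ 1#))
      (≤-<-trans (+-monoˡ-≤ 0# (lower y≤c)) (+-monoʳ-< (y + c ×ᴿ 1#) 0<1)))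
    (<-resp (+-identityʳ _)
      (≈-trans (S.solve 1 (λ c → (c S.:+ (S.con 1 S.:+ c)) S.:+ S.con 1 S.:= (c S.:+ c) S.:+
          (S.con 1 S.:+ S.con 1)) ≈-refl (c ×ᴿ 1#))
        (+-congʳ (≈-sym (×-homo-+ 1# c c))))
      (≤-<-trans (+-monoˡ-≤ 0# (+-monoˡ-≤ (suc c ×ᴿ 1#) (upper y≤c)))
        (+-monoʳ-< (c ×ᴿ 1# + suc c ×ᴿ 1#) 0<1)))

  same-cell : ∀ {k x y} z → x + z < k + (1# + 1#) → k < y + z → x + - y ≤ 1# + 1#
  same-cell {k} {x} {y} z x< k< = <⇒≤ (+-cancelʳ-< y (<-resp (≈-sym (y-x+x≈y y x)) (+-comm y _)
    (+-cancelʳ-< z (<-respʳ (S.solve 3 (λ y z t → (y S.:+ z) S.:+ t S.:= (y S.:+ t) S.:+ z) ≈-refl y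
        z (1# + 1#))
      (<-trans x< (+-monoˡ-< (1# + 1#) k<))))))

-- Inner products over an ordered ring

record EuclideanModule (A : ArchimedeanOrderedRing) (c ℓ : Level) : Set (lsuc (c ⊔ ℓ)) where
  open OrderedRing A hiding (_×ᴿ_)
  infix 8 ⟨_,_⟩
  field
    underlyingModule : Module commutativeRing c ℓ
  open Module underlyingModule public
  field
    ⟨_,_⟩       : Carrierᴹ → Carrierᴹ → Carrier
    ⟨⟩-cong     : ∀ {u u′ v v′} → u ≈ᴹ u′ → v ≈ᴹ v′ → ⟨ u , v ⟩ ≈ ⟨ u′ , v′ ⟩
    ⟨⟩-sym      : ∀ u v → ⟨ u , v ⟩ ≈ ⟨ v , u ⟩
    ⟨⟩-+ˡ       : ∀ u v w → ⟨ u +ᴹ v , w ⟩ ≈ ⟨ u , w ⟩ + ⟨ v , w ⟩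
    ⟨⟩-*ˡ       : ∀ r u v → ⟨ r *ₗ u , v ⟩ ≈ r * ⟨ u , v ⟩
    ⟨⟩-nonNeg   : ∀ v → 0# ≤ ⟨ v , v ⟩
    ⟨⟩-definite : ∀ v → ⟨ v , v ⟩ ≈ 0# → v ≈ᴹ 0ᴹ

module Euclidean {A : ArchimedeanOrderedRing} {c ℓ} (E : EuclideanModule A c ℓ) where
  open OrderedRing A public
  open EuclideanModule E public
  open AbelianGroupProperties +ᴹ-abelianGroup public
    using () renaming (∙-cancelʳ to +ᴹ-cancelʳ; //-rightDividesʳ to x+y-y≈x; x∙y⁻¹≈ε⇒x≈y to
        x-y≈0⇒x≈y; ⁻¹-∙-comm to -ᴹ-+ᴹ-comm; ⁻¹-involutive to -ᴹ-involutive)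
  open CommutativeMonoidMult +ᴹ-commutativeMonoid public
    using () renaming (_×_ to _·_; ×-congˡ to ·-congˡ; ×-homo-+ to ·-homo-+)
  open CommutativeMonoidMult +-commutativeMonoid
    using (×-congʳ; ×-assocˡ)
  module MonoidSolver = CommutativeMonoidSolver +ᴹ-commutativeMonoid
  open MonoidSolver public using (_⊕_; _⊜_)
  module SumV = CommutativeMonoidSum +ᴹ-commutativeMonoid
  module SumR = CommutativeMonoidSum +-commutativeMonoid

  infixl 6 _-ᴹ_
  _-ᴹ_ : Carrierᴹ → Carrierᴹ → Carrierᴹ
  u -ᴹ v = u +ᴹ (-ᴹ v)

  -- Squared length: with it the parallelogram law is a ring identity and no square roots occur.
  N : Carrierᴹ → Carrier
  N v = ⟨ v , v ⟩

  N-cong : ∀ {u v} → u ≈ᴹ v → N u ≈ N v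
  N-cong p = ⟨⟩-cong p p

  ⟨⟩-+ʳ : ∀ u v w → ⟨ u , v +ᴹ w ⟩ ≈ ⟨ u , v ⟩ + ⟨ u , w ⟩
  ⟨⟩-+ʳ u v w = ≈-trans (⟨⟩-sym u (v +ᴹ w))
      (≈-trans (⟨⟩-+ˡ v w u) (+-cong (⟨⟩-sym v u) (⟨⟩-sym w u)))

  ⟨⟩-0ˡ : ∀ v → ⟨ 0ᴹ , v ⟩ ≈ 0#
  ⟨⟩-0ˡ v = ≈-trans (⟨⟩-cong (≈ᴹ-sym (*ₗ-zeroˡ v)) ≈ᴹ-refl) (≈-trans (⟨⟩-*ˡ 0# v v) (zeroˡ _))

  ⟨⟩-inverse : ∀ u v → ⟨ u , v ⟩ + ⟨ -ᴹ u , v ⟩ ≈ 0#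
  ⟨⟩-inverse u v = ≈-trans (≈-sym (⟨⟩-+ˡ u (-ᴹ u) v)) (≈-trans (⟨⟩-cong (-ᴹ‿inverseʳ u) ≈ᴹ-refl)
      (⟨⟩-0ˡ v))

  N-neg : ∀ v → N (-ᴹ v) ≈ N v
  N-neg v = begin
    N (-ᴹ v)                                        ≈⟨ +-identityˡ _ ⟨
    0# + N (-ᴹ v)                                   ≈⟨ +-congʳ (⟨⟩-inverse v v) ⟨
    N v + ⟨ -ᴹ v , v ⟩ + N (-ᴹ v)                   ≈⟨ +-assoc _ _ _ ⟩
    N v + (⟨ -ᴹ v , v ⟩ + N (-ᴹ v))                 ≈⟨ +-congˡ (+-congʳ (⟨⟩-sym (-ᴹ v) v)) ⟩
    N v + (⟨ v , -ᴹ v ⟩ + ⟨ -ᴹ v , -ᴹ v ⟩)          ≈⟨ +-congˡ (⟨⟩-inverse v (-ᴹ v)) ⟩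
    N v + 0#                                        ≈⟨ +-identityʳ _ ⟩
    N v ∎
    where open SetoidReasoning setoid

  N-+ : ∀ u v → N (u +ᴹ v) ≈ N u + ⟨ u , v ⟩ + (⟨ u , v ⟩ + N v)
  N-+ u v = ≈-trans (⟨⟩-+ˡ u v (u +ᴹ v))
    (+-cong (⟨⟩-+ʳ u u v) (≈-trans (⟨⟩-+ʳ v u v) (+-congʳ (⟨⟩-sym v u))))

  parallelogram : ∀ u v → N (u +ᴹ v) + N (u -ᴹ v) ≈ (N u + N u) + (N v + N v)
  parallelogram u v = begin
    N (u +ᴹ v) + N (u -ᴹ v)
      ≈⟨ +-cong (N-+ u v) (≈-trans (N-+ u (-ᴹ v)) (+-congˡ (+-congˡ (N-neg v)))) ⟩
    (N u + ⟨ u , v ⟩ + (⟨ u , v ⟩ + N v)) + (N u + ⟨ u , -ᴹ v ⟩ + (⟨ u , -ᴹ v ⟩ + N v))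
      ≈⟨ S.solve 4 (λ a b c d → (a S.:+ c S.:+ (c S.:+ b)) S.:+ (a S.:+ d S.:+ (d S.:+ b))
           S.:= ((c S.:+ d) S.:+ (c S.:+ d)) S.:+ ((a S.:+ a) S.:+ (b S.:+ b))) ≈-refl (N u)
               (N v) ⟨ u , v ⟩ ⟨ u , -ᴹ v ⟩ ⟩
    (⟨ u , v ⟩ + ⟨ u , -ᴹ v ⟩ + (⟨ u , v ⟩ + ⟨ u , -ᴹ v ⟩)) + ((N u + N u) + (N v + N v))
      ≈⟨ +-congʳ (+-cong cancel cancel) ⟩
    0# + 0# + ((N u + N u) + (N v + N v))
      ≈⟨ ≈-trans (+-congʳ (+-identityˡ 0#)) (+-identityˡ _) ⟩
    (N u + N u) + (N v + N v) ∎
    where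
    open SetoidReasoning setoid
    cancel : ⟨ u , v ⟩ + ⟨ u , -ᴹ v ⟩ ≈ 0#
    cancel = ≈-trans (+-cong (⟨⟩-sym u v) (⟨⟩-sym u (-ᴹ v))) (⟨⟩-inverse v u)

  N-+-≤ : ∀ u v → N (u +ᴹ v) ≤ (N u + N u) + (N v + N v)
  N-+-≤ u v = ≤-resp ≈-refl (parallelogram u v) (x≤x+nonNeg (⟨⟩-nonNeg (u -ᴹ v)))

  N--≤ : ∀ u v → N (u -ᴹ v) ≤ (N u + N u) + (N v + N v)
  N--≤ u v = ≤-resp ≈-refl (≈-trans (+-comm _ _) (parallelogram u v))
      (x≤x+nonNeg (⟨⟩-nonNeg (u +ᴹ v)))

  four : Carrier → Carrier
  four x = (x + x) + (x + x)

  N-double : ∀ u → N (u +ᴹ u) ≈ four (N u)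
  N-double u = ≈-trans (N-+ u u) ≈-refl

  N-*ₗ : ∀ r v → N (r *ₗ v) ≈ r * r * N v
  N-*ₗ r v = ≈-trans (⟨⟩-*ˡ r v (r *ₗ v)) (≈-trans (*-congˡ (≈-trans (⟨⟩-sym v _) (⟨⟩-*ˡ r v v)))
      (≈-sym (*-assoc r r _)))

  ⟨⟩-·ˡ : ∀ n u v → ⟨ n · u , v ⟩ ≈ n ×ᴿ ⟨ u , v ⟩
  ⟨⟩-·ˡ zero    u v = ⟨⟩-0ˡ v
  ⟨⟩-·ˡ (suc n) u v = ≈-trans (⟨⟩-+ˡ u (n · u) v) (+-congˡ (⟨⟩-·ˡ n u v))

  N-· : ∀ n v → N (n · v) ≈ (n ℕ.* n) ×ᴿ N v
  N-· n v = ≈-trans (⟨⟩-·ˡ n v (n · v))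
    (≈-trans (×-congʳ n (≈-trans (⟨⟩-sym v _) (⟨⟩-·ˡ n v v))) (×-assocˡ _ n n))

  four-cancel-≤ : ∀ {x} → four x ≤ 0# → x ≤ 0#
  four-cancel-≤ h 0<x = h (<-resp (≈-trans (+-cong (+-identityˡ 0#) (+-identityˡ 0#))
      (+-identityˡ 0#)) ≈-refl
    (+-mono-< (+-mono-< 0<x 0<x) (+-mono-< 0<x 0<x)))

  -- Definiteness excludes 2-torsion: w = u - v satisfies 4 N w = N (w + w) = 0.
  double-cancel : ∀ {u v} → u +ᴹ u ≈ᴹ v +ᴹ v → u ≈ᴹ v
  double-cancel {u} {v} eq =
      x-y≈0⇒x≈y u v (⟨⟩-definite w (tight (⟨⟩-nonNeg w) (four-cancel-≤ (≤-reflexive fourN≈0))))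
    where
    w = u -ᴹ v
    2w≈0 : w +ᴹ w ≈ᴹ 0ᴹ
    2w≈0 = begin
      (u -ᴹ v) +ᴹ (u -ᴹ v)
        ≈⟨ MonoidSolver.solve 2 (λ u v → (u ⊕ v) ⊕ (u ⊕ v) ⊜ (u ⊕ u) ⊕ (v ⊕ v)) ≈ᴹ-refl u (-ᴹ v) ⟩
      (u +ᴹ u) +ᴹ (-ᴹ v +ᴹ -ᴹ v)   ≈⟨ +ᴹ-cong eq (-ᴹ-+ᴹ-comm v v) ⟩
      (v +ᴹ v) -ᴹ (v +ᴹ v)         ≈⟨ -ᴹ‿inverseʳ _ ⟩
      0ᴹ ∎
      where open SetoidReasoning ≈ᴹ-setoid
    fourN≈0 : four (N w) ≈ 0#
    fourN≈0 = ≈-trans (≈-sym (N-double w)) (≈-trans (N-cong 2w≈0) (⟨⟩-0ˡ 0ᴹ))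

  linearCombination : ∀ {k} → (Fin k → Carrier) → (Fin k → Carrierᴹ) → Carrierᴹ
  linearCombination r v = SumV.sum (λ i → r i *ₗ v i)

  -- Induction on the number of vectors with N (u + v) ≤ 2 N u + 2 N v. The constant grows with d,
  -- but only its existence matters.
  N-bounded-on-boxes : ∀ {d} (τ : Carrier) (b : Fin d → Carrierᴹ) →
    ∃[ C ] (∀ r → (∀ j → r j * r j ≤ τ) → N (linearCombination r b) ≤ C)
  N-bounded-on-boxes {zero} τ b = 0# , λ r _ → ≤-reflexive (⟨⟩-0ˡ 0ᴹ)
  N-bounded-on-boxes {suc d} τ b =
    let C , h = N-bounded-on-boxes τ (b ∘ suc)
        t = τ * N (b zero)
    in (t + t) + (C + C) , λ r r²≤τ →
      let head = ≤-resp (≈-sym (N-*ₗ (r zero) (b zero))) ≈-refl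
                   (*-monoʳ-≤ (⟨⟩-nonNeg (b zero)) (r²≤τ zero))
          tail = h (r ∘ suc) (r²≤τ ∘ suc)
      in ≤-trans (N-+-≤ (r zero *ₗ b zero) (linearCombination (r ∘ suc) (b ∘ suc)))
           (+-mono-≤ (+-mono-≤ head head) (+-mono-≤ tail tail))

  module Coordinates {d} (b : Fin d → Carrierᴹ) where

    HasCoordinates : Carrierᴹ → (Fin d → Carrier) → Set ℓ
    HasCoordinates u y = u ≈ᴹ linearCombination y b

    coordinates-+ : ∀ {u v y z} → HasCoordinates u y → HasCoordinates v z →
        HasCoordinates (u +ᴹ v) (λ j → y j + z j)
    coordinates-+ {y = y} {z} p q = ≈ᴹ-trans (+ᴹ-cong p q) (≈ᴹ-sym (≈ᴹ-trans
      (SumV.sum-cong-≋ (λ j → *ₗ-distribʳ (b j) (y j) (z j)))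
      (SumV.∑-distrib-+ (λ j → y j *ₗ b j) (λ j → z j *ₗ b j))))

    coordinates-0 : HasCoordinates 0ᴹ (λ _ → 0#)
    coordinates-0 = ≈ᴹ-sym (≈ᴹ-trans (SumV.sum-cong-≋ (λ j → *ₗ-zeroˡ (b j)))
        (SumV.sum-replicate-zero d))

    coordinates-· : ∀ n {u y} → HasCoordinates u y → HasCoordinates (n · u) (λ j → n ×ᴿ y j)
    coordinates-· zero    p = coordinates-0
    coordinates-· (suc n) p = coordinates-+ p (coordinates-· n p)

    coordinates-cong : ∀ {u y z} → (∀ j → y j ≈ z j) → HasCoordinates u y → HasCoordinates u z
    coordinates-cong y≈z p = ≈ᴹ-trans p (SumV.sum-cong-≋ (λ j → *ₗ-cong (y≈z j) ≈ᴹ-refl))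

    coordinates-- : ∀ {u v y z} → HasCoordinates u y → HasCoordinates v z →
        HasCoordinates (u -ᴹ v) (λ j → y j + - z j)
    coordinates-- {u} {v} {y} {z} p q = +ᴹ-cancelʳ (linearCombination z b) _ _ (begin
      (u -ᴹ v) +ᴹ linearCombination z b   ≈⟨ +ᴹ-congˡ q ⟨
      (u -ᴹ v) +ᴹ v                       ≈⟨ +ᴹ-assoc u (-ᴹ v) v ⟩
      u +ᴹ (-ᴹ v +ᴹ v)                    ≈⟨ +ᴹ-congˡ (-ᴹ‿inverseˡ v) ⟩
      u +ᴹ 0ᴹ                             ≈⟨ +ᴹ-identityʳ u ⟩
      u                                   ≈⟨ p ⟩
      linearCombination y b
        ≈⟨ coordinates-cong {linearCombination y b} (λ j → ≈-sym (y-x+x≈y (z j) (y j))) ≈ᴹ-refl ⟩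
      linearCombination (λ j → y j + - z j + z j) b
        ≈⟨ coordinates-+ {linearCombination _ b} {linearCombination z b} ≈ᴹ-refl ≈ᴹ-refl ⟨
      linearCombination (λ j → y j + - z j) b +ᴹ linearCombination z b ∎)
      where open SetoidReasoning ≈ᴹ-setoid

  -- Natural coefficients suffice, since signs disappear modulo 2L and the pigeonhole argument draws
  -- its coefficients from `Fin K`.
  combination : ∀ {r} → (Fin r → ℕ) → (Fin r → Carrierᴹ) → Carrierᴹ
  combination m g = SumV.sum (λ i → m i · g i)

  combination-cong : ∀ {r} {m m′ : Fin r → ℕ} g → (∀ i → m i ≡ m′ i) →
      combination m g ≈ᴹ combination m′ g
  combination-cong g m≡m′ = SumV.sum-cong-≋ (λ i → ·-congˡ (m≡m′ i))

  combination-+ : ∀ {r} (m m′ : Fin r → ℕ) g →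
    combination (λ i → m i ℕ.+ m′ i) g ≈ᴹ combination m g +ᴹ combination m′ g
  combination-+ m m′ g = ≈ᴹ-trans (SumV.sum-cong-≋ (λ i → ·-homo-+ (g i) (m i) (m′ i)))
      (SumV.∑-distrib-+ (λ i → m i · g i) (λ i → m′ i · g i))

-- Discrete subgroups modulo 2

module Arithmetic where

  funToFin-cong : ∀ {m n} {f g : Fin m → Fin n} → (∀ i → f i ≡ g i) → funToFin f ≡ funToFin g
  funToFin-cong {zero}  f≡g = refl
  funToFin-cong {suc m} f≡g = cong₂ combine (f≡g zero) (funToFin-cong (f≡g ∘ suc))

  finToFun-injective : ∀ {m n} {x y : Fin (m ^ n)} → (∀ i → finToFun {m} {n} x i ≡ finToFun y i) →
      x ≡ y
  finToFun-injective {m} {n} {x} {y} eq = trans (sym (Fin.funToFin-finToFin {n} {m} x))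
    (trans (funToFin-cong eq) (Fin.funToFin-finToFin {n} {m} y))

  pigeonhole-functions : ∀ {m n k} → n ^ m ℕ.< k → (f : Fin k → Fin m → Fin n) →
    ∃₂ λ x y → x Fin.< y × (∀ i → f x i ≡ f y i)
  pigeonhole-functions n^m<k f =
    let x , y , x<y , eq = Fin.pigeonhole n^m<k (funToFin ∘ f)
    in x , y , x<y , λ i → trans (sym (Fin.finToFun-funToFin (f x) i))
         (trans (cong (λ z → finToFun z i) eq) (Fin.finToFun-funToFin (f y) i))

  m≤m² : ∀ m → m ℕ.≤ m ℕ.* m
  m≤m² zero    = z≤n
  m≤m² (suc m) = ℕ.m≤m*n (suc m) (suc m)

  n<2^n : ∀ n → n ℕ.< 2 ^ n
  n<2^n zero    = s≤s z≤n
  n<2^n (suc n) = ℕ.≤-trans (s≤s (n<2^n n))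
    (ℕ.≤-trans (ℕ.+-monoˡ-≤ (2 ^ n) (ℕ.m^n>0 2 n)) (ℕ.+-monoʳ-≤ (2 ^ n) (ℕ.m≤m+n (2 ^ n) 0)))

  ^-distribʳ-* : ∀ m n k → (m ℕ.* n) ^ k ≡ m ^ k ℕ.* n ^ k
  ^-distribʳ-* m n zero    = refl
  ^-distribʳ-* m n (suc k) = trans (cong (m ℕ.* n ℕ.*_) (^-distribʳ-* m n k))
    (solve 4 (λ m n a b → m :* n :* (a :* b) := m :* a :* (n :* b)) refl m n (m ^ k) (n ^ k))
    where open +-*-Solver

  -- The choice K = 2 ^ (e ^ d) works because n < 2 ^ n absorbs the constant factor e ^ d.
  cells<points : ∀ e {d r} → d ℕ.≤ r → let K = 2 ^ (e ^ d) in (K ℕ.* e) ^ d ℕ.< K ^ suc r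
  cells<points e {d} {r} d≤r = begin-strict
    (K ℕ.* e) ^ d     ≡⟨ ^-distribʳ-* K e d ⟩
    K ^ d ℕ.* e ^ d   <⟨ ℕ.*-monoʳ-< (K ^ d) {{ℕ.m^n≢0 K d}} (n<2^n (e ^ d)) ⟩
    K ^ d ℕ.* K       ≡⟨ ℕ.*-comm (K ^ d) K ⟩
    K ^ suc d         ≤⟨ ℕ.^-monoʳ-≤ K (s≤s d≤r) ⟩
    K ^ suc r         ∎
    where
    open ℕ.≤-Reasoning
    K = 2 ^ (e ^ d)
    instance
      K≢0 : NonZero K
      K≢0 = ℕ.m^n≢0 2 (e ^ d)

  n%2≡0⊎1 : ∀ n → n % 2 ≡ 0 ⊎ n % 2 ≡ 1
  n%2≡0⊎1 n with n % 2 | m%n<n n 2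
  ... | 0 | _ = inj₁ refl
  ... | 1 | _ = inj₂ refl
  ... | suc (suc _) | s≤s (s≤s ())

  n≡n%2+n/2+n/2 : ∀ n → n ≡ n % 2 ℕ.+ (n / 2 ℕ.+ n / 2)
  n≡n%2+n/2+n/2 n = trans (m≡m%n+[m/n]*n n 2)
    (cong (n % 2 ℕ.+_) (trans (ℕ.*-comm (n / 2) 2) (cong (n / 2 ℕ.+_) (ℕ.+-identityʳ (n / 2)))))

  -- Congruence modulo 2 is expressed throughout by evenness of a sum, which avoids subtraction in
  -- `ℕ`; this lemma and `%2-≡⇒even-+` translate to residues.
  even-+⇒%2-≡ : ∀ m n → 2 ∣ m ℕ.+ n → m % 2 ≡ n % 2
  even-+⇒%2-≡ m n 2∣ with n%2≡0⊎1 m | n%2≡0⊎1 n | trans (sym (%-distribˡ-+ m n 2))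
      (n∣m⇒m%n≡0 (m ℕ.+ n) 2 2∣)
  ... | inj₁ p | inj₁ q | _ = trans p (sym q)
  ... | inj₂ p | inj₂ q | _ = trans p (sym q)
  ... | inj₁ p | inj₂ q | h rewrite p | q with () ← h
  ... | inj₂ p | inj₁ q | h rewrite p | q with () ← h

  2∣n+n : ∀ n → 2 ∣ n ℕ.+ n
  2∣n+n n = divides n (trans (cong (n ℕ.+_) (sym (ℕ.+-identityʳ n))) (ℕ.*-comm 2 n))

  %2-≡⇒even-+ : ∀ m n → m % 2 ≡ n % 2 → 2 ∣ m ℕ.+ n
  %2-≡⇒even-+ m n eq = m%n≡0⇒n∣m (m ℕ.+ n) 2 (trans (%-distribˡ-+ m n 2)
    (trans (cong (λ z → (z ℕ.+ n % 2) % 2) eq) (n∣m⇒m%n≡0 (n % 2 ℕ.+ n % 2) 2 (2∣n+n (n % 2)))))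

  common-bound : ∀ {n} {P : Fin n → ℕ → Set} → (∀ {i a b} → a ℕ.≤ b → P i a → P i b) →
    (∀ i → ∃ (P i)) → ∃[ c ] (∀ i → P i c)
  common-bound {zero}  mono h = 0 , λ ()
  common-bound {suc n} mono h =
    let a , p = h zero
        b , q = common-bound mono (h ∘ suc)
    in a ℕ.⊔ b , λ { zero → mono (ℕ.m≤m⊔n a b) p ; (suc i) → mono (ℕ.m≤n⊔m a b) (q i) }

open Arithmetic

module _ {A : ArchimedeanOrderedRing} {c ℓ} (E : EuclideanModule A c ℓ) where
  open Euclidean E

  -- Smallness in `discrete` is `¬ ε ≤ N v`, that is `¬ ¬ N v < ε`, so that it can be established by
  -- refuting `ε ≤ N v`.
  record IsDiscreteSubgroup {p} (L : Carrierᴹ → Set p) : Set (c ⊔ ℓ ⊔ p) where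
    field
      resp       : ∀ {u v} → u ≈ᴹ v → L u → L v
      0-closed   : L 0ᴹ
      +-closed   : ∀ {u v} → L u → L v → L (u +ᴹ v)
      neg-closed : ∀ {v} → L v → L (-ᴹ v)
      discrete   : ∃[ ε ] (0# < ε × (∀ v → L v → ¬ ε ≤ N v → v ≈ᴹ 0ᴹ))

module DiscreteSubgroup {A : ArchimedeanOrderedRing} {c ℓ} (E : EuclideanModule A c ℓ)
  {p} {L : Euclidean.Carrierᴹ E → Set p} (Λ : IsDiscreteSubgroup E L) where
  open Euclidean E
  open IsDiscreteSubgroup Λ public

  ·-closed : ∀ n {v} → L v → L (n · v)
  ·-closed zero    v∈L = 0-closed
  ·-closed (suc n) v∈L = +-closed v∈L (·-closed n v∈L)

  combination-closed : ∀ {r} (m : Fin r → ℕ) {g} → (∀ i → L (g i)) → L (combination m g)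
  combination-closed {zero}  m g∈L = 0-closed
  combination-closed {suc r} m g∈L = +-closed (·-closed (m zero) (g∈L zero))
      (combination-closed (m ∘ suc) (g∈L ∘ suc))

  -- Membership in 2L. For lattice vectors, `Doubled (u +ᴹ v)` means congruence modulo 2L, because u
  -- + v and u - v differ by 2v.
  Doubled : Carrierᴹ → Set _
  Doubled v = ∃[ w ] (L w × v ≈ᴹ w +ᴹ w)

  doubled-resp : ∀ {u v} → u ≈ᴹ v → Doubled u → Doubled v
  doubled-resp u≈v (w , w∈L , u≈2w) = w , w∈L , ≈ᴹ-trans (≈ᴹ-sym u≈v) u≈2w

  doubled-+ : ∀ {u v} → Doubled u → Doubled v → Doubled (u +ᴹ v)
  doubled-+ (w , w∈L , u≈2w) (x , x∈L , v≈2x) = w +ᴹ x , +-closed w∈L x∈L ,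
    ≈ᴹ-trans (+ᴹ-cong u≈2w v≈2x)
      (MonoidSolver.solve 2 (λ w x → (w ⊕ w) ⊕ (x ⊕ x) ⊜ (w ⊕ x) ⊕ (w ⊕ x)) ≈ᴹ-refl w x)

  doubled-self : ∀ {v} → L v → Doubled (v +ᴹ v)
  doubled-self {v} v∈L = v , v∈L , ≈ᴹ-refl

  doubled-neg : ∀ {v} → Doubled v → Doubled (-ᴹ v)
  doubled-neg (w , w∈L , v≈2w) = -ᴹ w , neg-closed w∈L ,
      ≈ᴹ-trans (-ᴹ‿cong v≈2w) (≈ᴹ-sym (-ᴹ-+ᴹ-comm w w))

  doubled-cancelʳ : ∀ {u v} → Doubled (u +ᴹ v) → Doubled v → Doubled u
  doubled-cancelʳ {u} {v} p q = doubled-resp (x+y-y≈x v u) (doubled-+ p (doubled-neg q))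

  doubled-combination : ∀ {r} (m : Fin r → ℕ) {g} → (∀ i → L (g i)) → (∀ i → 2 ∣ m i) →
      Doubled (combination m g)
  doubled-combination m {g} g∈L even = doubled-resp
    (≈ᴹ-trans (≈ᴹ-sym (combination-+ h h g)) (combination-cong g λ i →
        sym (trans (n≡n%2+n/2+n/2 (m i))
      (cong (ℕ._+ (h i ℕ.+ h i)) (n∣m⇒m%n≡0 (m i) 2 (even i))))))
    (doubled-self (combination-closed h g∈L))
    where h = λ i → m i / 2

  -- The rank modulo 2 is at most the dimension

  module _ {d} (b : Fin d → Carrierᴹ) (spanning : ∀ v → ∃[ y ] v ≈ᴹ linearCombination y b) where
    open Coordinates b

    -- A scale that separates lattice points. The 2 is the width of the overlapping cells of
    -- `locate`, so lattice vectors whose scaled coordinates share all cells coincide.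
    record Resolution : Set (c ⊔ ℓ ⊔ p) where
      field
        scale : ℕ
        fine  : ∀ {w s} → L w → HasCoordinates w s →
                (∀ j → scale ×ᴿ s j ≤ 1# + 1#) → (∀ j → - (scale ×ᴿ s j) ≤ 1# + 1#) → w ≈ᴹ 0ᴹ

    -- Were ε ≤ N w, then D² ε ≤ D² N w = N (D w) ≤ C, against C < D ε ≤ D² ε. Here C bounds `N` on
    -- the box of coordinates with squares at most 2².
    resolution : Resolution
    resolution with discrete | N-bounded-on-boxes ((1# + 1#) * (1# + 1#)) b
    ... | ε , 0<ε , isolated | C , C-bound with archimedean C 0<ε
    ... | D , C<Dε = record { scale = D ; fine = fine }
      where
      fine : ∀ {w s} → L w → HasCoordinates w s →
             (∀ j → D ×ᴿ s j ≤ 1# + 1#) → (∀ j → - (D ×ᴿ s j) ≤ 1# + 1#) → w ≈ᴹ 0ᴹ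
      fine {w} {s} w∈L w-coordinates h h′ = isolated w w∈L λ ε≤Nw → <-irrefl ≈-refl
        (<-≤-trans C<Dε (≤-trans (×-monoˡ-≤ (<⇒≤ 0<ε) (m≤m² D))
            (≤-trans (×-mono-≤ (D ℕ.* D) ε≤Nw) D²Nw≤C)))
        where
        D²Nw≤C : (D ℕ.* D) ×ᴿ N w ≤ C
        D²Nw≤C = ≤-resp (≈-trans (N-cong (≈ᴹ-sym (coordinates-· D w-coordinates))) (N-· D w)) ≈-refl
          (C-bound (λ j → D ×ᴿ s j) (λ j → square-bound (h j) (h′ j)))

    coordinate : ∀ {n K} → (Fin n → Fin K) → (Fin n → Fin d → Carrier) → Fin d → Carrier
    coordinate {zero}  m a j = 0#
    coordinate {suc n} m a j = toℕ (m zero) ×ᴿ a zero j + coordinate (m ∘ suc) (a ∘ suc) j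

    combination-coordinates : ∀ {n K} (m : Fin n → Fin K) {g : Fin n → Carrierᴹ} {a} →
      (∀ i → HasCoordinates (g i) (a i)) → HasCoordinates (combination (toℕ ∘ m) g) (coordinate m a)
    combination-coordinates {zero}  m h = coordinates-0
    combination-coordinates {suc n} m h =
      coordinates-+ (coordinates-· (toℕ (m zero)) (h zero)) (combination-coordinates (m ∘ suc)
          (h ∘ suc))

    coordinate-bound : ∀ {n K B} (m : Fin n → Fin K) {a} → (∀ i j → ∣ a i j ∣≤ B) →
      ∀ j → ∣ coordinate m a j ∣≤ n ℕ.* (K ℕ.* B)
    coordinate-bound {zero}  m h j = ∣∣≤-0 0
    coordinate-bound {suc n} {B = B} m h j = ∣∣≤-+
      (∣∣≤-mono (ℕ.*-monoˡ-≤ B (ℕ.<⇒≤ (Fin.toℕ<n (m zero)))) (∣∣≤-× (toℕ (m zero)) (h zero j)))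
      (coordinate-bound (m ∘ suc) (h ∘ suc) j)

    -- Two of the combinations with coefficients below a large K have nearly
    -- equal coordinates; their difference is then 0 by discreteness.
    coincidence : ∀ {r} → d ℕ.≤ r → (g : Fin (suc r) → Carrierᴹ) → (∀ i → L (g i)) →
      ∃[ k ] ∃₂ λ (m m′ : Fin (suc r) → Fin (2 ^ k)) →
        ¬ (∀ i → m i ≡ m′ i) × combination (toℕ ∘ m) g ≈ᴹ combination (toℕ ∘ m′) g
    coincidence {r} d≤r g g∈L =
      fromBound resolution (λ i → proj₁ (spanning (g i))) (λ i → proj₂ (spanning (g i)))
        (common-bound (λ le h j → ∣∣≤-mono le (h j)) (λ i → common-bound ∣∣≤-mono (λ j →
            bounded _)))
      where
      fromBound : Resolution → (a : Fin (suc r) → Fin d → Carrier) →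
          (∀ i → HasCoordinates (g i) (a i)) →
        ∃[ B ] (∀ i j → ∣ a i j ∣≤ B) →
        ∃[ k ] ∃₂ λ (m m′ : Fin (suc r) → Fin (2 ^ k)) →
          ¬ (∀ i → m i ≡ m′ i) × combination (toℕ ∘ m) g ≈ᴹ combination (toℕ ∘ m′) g
      -- The number of coefficient values is a power of two so that `halve` can descend on its
      -- exponent.
      fromBound R a g-coordinates (B , a≤B) = e ^ d , collide (2 ^ (e ^ d)) (cells<points e d≤r)
        where
        open Resolution R renaming (scale to D)
        -- Scaled coordinates of combinations with coefficients below K are at most K F in absolute
        -- value. Cell indices run up to 2 K F, which is less than K e for e = 2F + 1.
        F = D ℕ.* (suc r ℕ.* B)
        e = suc (F ℕ.+ F)
        collide : ∀ K → (K ℕ.* e) ^ d ℕ.< K ^ suc r → ∃₂ λ (m m′ : Fin (suc r) → Fin K) →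
          ¬ (∀ i → m i ≡ m′ i) × combination (toℕ ∘ m) g ≈ᴹ combination (toℕ ∘ m′) g
        collide K cells< = finish (pigeonhole-functions cells< (λ x j →
            fromℕ< (cell< (cells (z x j) (z-bound x j)))))
          where
          m : Fin (K ^ suc r) → Fin (suc r) → Fin K
          m = finToFun
          z : Fin (K ^ suc r) → Fin d → Carrier
          z x j = D ×ᴿ coordinate (m x) a j
          z-bound : ∀ x j → ∣ z x j ∣≤ K ℕ.* F
          z-bound x j = subst (∣ z x j ∣≤_)
            (solve 4 (λ D r K B → D :* (r :* (K :* B)) := K :* (D :* (r :* B))) refl D (suc r) K B)
            (∣∣≤-× D (coordinate-bound (m x) a≤B j))
            where open +-*-Solver
          0<K : 0 ℕ.< K
          0<K = ℕ.n≢0⇒n>0 λ { refl → ℕ.n≮0 cells< }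
          record Cell (x : Carrier) : Set where
            field
              index : ℕ
              cell< : index ℕ.< K ℕ.* e
              lower : index ×ᴿ 1# < x + suc (K ℕ.* F) ×ᴿ 1#
              upper : x + suc (K ℕ.* F) ×ᴿ 1# < index ×ᴿ 1# + (1# + 1#)
          open Cell using (cell<)
          cells : ∀ x → ∣ x ∣≤ K ℕ.* F → Cell x
          cells x h = let k , k≤ , l , u = locate-∣∣≤ (K ℕ.* F) h in record
            { index = k
            ; cell< = ℕ.≤-<-trans k≤ (subst (ℕ._< K ℕ.* e) (ℕ.*-distribˡ-+ K F F)
                (ℕ.*-monoʳ-< K {{ℕ.>-nonZero 0<K}} (ℕ.n<1+n (F ℕ.+ F))))
            ; lower = l ; upper = u }
          close : ∀ {x x′ j} (C : Cell (z x j)) (C′ : Cell (z x′ j)) →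
              Cell.index C ≡ Cell.index C′ →
            D ×ᴿ (coordinate (m x) a j + - coordinate (m x′) a j) ≤ 1# + 1#
          close {x} {x′} {j} C C′ eq = ≤-resp (≈-sym (×-distrib-- D _ _)) ≈-refl
            (same-cell (suc (K ℕ.* F) ×ᴿ 1#) (Cell.upper C) (<-respˡ (×-congˡ (sym eq))
                (Cell.lower C′)))
          finish : (∃₂ λ x y → x Fin.< y ×
            (∀ j → fromℕ< (cell< (cells (z x j) (z-bound x j))) ≡
                   fromℕ< (cell< (cells (z y j) (z-bound y j))))) → _
          finish (x , x′ , x<x′ , same) = m x , m x′ ,
            (λ eq → Fin.<-irrefl (finToFun-injective {K} {suc r} eq) x<x′) ,
            x-y≈0⇒x≈y _ _ (fine
              (+-closed (combination-closed (toℕ ∘ m x) g∈L)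
                  (neg-closed (combination-closed (toℕ ∘ m x′) g∈L)))
              (coordinates-- (combination-coordinates (m x) g-coordinates) (combination-coordinates
                  (m x′) g-coordinates))
              (λ j → close (cells _ (z-bound x j)) (cells _ (z-bound x′ j)) (same-index j))
              (λ j → ≤-resp (≈-sym (negate j)) ≈-refl
                (close (cells _ (z-bound x′ j)) (cells _ (z-bound x j)) (sym (same-index j)))))
            where
            same-index : ∀ j →
              Cell.index (cells (z x j) (z-bound x j)) ≡ Cell.index (cells (z x′ j) (z-bound x′ j))
            same-index j = Fin.fromℕ<-injective _ _ (cell< (cells (z x j) (z-bound x j)))
                (cell< (cells (z x′ j) (z-bound x′ j))) (same j)
            negate : ∀ j → - (D ×ᴿ (coordinate (m x) a j + - coordinate (m x′) a j)) ≈
                           D ×ᴿ (coordinate (m x′) a j + - coordinate (m x) a j)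
            negate j = ≈-trans (-‿cong (×-distrib-- D _ _)) (≈-trans (-‿anti-homo-- _ _)
                (≈-sym (×-distrib-- D _ _)))

    -- If some m i + m′ i is odd, m + m′ is the desired relation, its combination being twice that
    -- of m. Otherwise m and m′ have equal parities, which cancel; the remaining even parts can be
    -- halved because there is no 2-torsion, and the bound 2^k halves with them. At k = 0 all
    -- coefficients are 0, so m and m′ could not differ.
    halve : ∀ {r} (g : Fin r → Carrierᴹ) → (∀ i → L (g i)) → ∀ k (m m′ : Fin r → ℕ) →
      (∀ i → m i ℕ.< 2 ^ k) → (∀ i → m′ i ℕ.< 2 ^ k) → ¬ (∀ i → m i ≡ m′ i) →
      combination m g ≈ᴹ combination m′ g →
      ∃[ c ] (¬ (∀ i → 2 ∣ c i) × Doubled (combination c g))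
    halve g g∈L zero m m′ m< m′< m≢m′ eq =
      ⊥-elim (m≢m′ λ i → trans (ℕ.n<1⇒n≡0 (m< i)) (sym (ℕ.n<1⇒n≡0 (m′< i))))
    halve {r} g g∈L (suc k) m m′ m< m′< m≢m′ eq with Fin.all? (λ i → 2 ∣? m i ℕ.+ m′ i)
    ... | no ¬even = (λ i → m i ℕ.+ m′ i) , ¬even ,
          doubled-resp (≈ᴹ-sym (≈ᴹ-trans (combination-+ m m′ g) (+ᴹ-congˡ (≈ᴹ-sym eq))))
              (doubled-self (combination-closed m g∈L))
    ... | yes even = halve g g∈L k (half m) (half m′) (half< m<) (half< m′<)
            (λ h → m≢m′ λ i → trans (n≡n%2+n/2+n/2 (m i))
              (trans (cong₂ ℕ._+_ (parity i) (cong₂ ℕ._+_ (h i) (h i)))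
                  (sym (n≡n%2+n/2+n/2 (m′ i)))))
            (double-cancel (+ᴹ-cancelʳ (combination (odd m) g) _ _ (begin
              (combination (half m) g +ᴹ combination (half m) g) +ᴹ combination (odd m) g ≈⟨
                  decompose m ⟨
              combination m g ≈⟨ eq ⟩
              combination m′ g ≈⟨ decompose m′ ⟩
              (combination (half m′) g +ᴹ combination (half m′) g) +ᴹ combination (odd m′) g
                ≈⟨ +ᴹ-congˡ (combination-cong g (λ i → sym (parity i))) ⟩
              (combination (half m′) g +ᴹ combination (half m′) g) +ᴹ combination (odd m) g ∎)))
      where
      open SetoidReasoning ≈ᴹ-setoid
      half : (Fin r → ℕ) → Fin r → ℕ
      half m i = m i / 2
      odd : (Fin r → ℕ) → Fin r → ℕ
      odd m i = m i % 2
      half< : ∀ {m} → (∀ i → m i ℕ.< 2 ^ suc k) → ∀ i → half m i ℕ.< 2 ^ k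
      half< {m} m< i = m<n*o⇒m/o<n (subst (m i ℕ.<_) (ℕ.*-comm 2 (2 ^ k)) (m< i))
      parity : ∀ i → m i % 2 ≡ m′ i % 2
      parity i = even-+⇒%2-≡ (m i) (m′ i) (even i)
      decompose : ∀ m →
        combination m g ≈ᴹ (combination (half m) g +ᴹ combination (half m) g) +ᴹ combination
            (odd m) g
      decompose m = begin
        combination m g
          ≈⟨ combination-cong g (λ i → trans (n≡n%2+n/2+n/2 (m i)) (ℕ.+-comm (m i % 2) _)) ⟩
        combination (λ i → (half m i ℕ.+ half m i) ℕ.+ m i % 2) g
          ≈⟨ combination-+ (λ i → half m i ℕ.+ half m i) (odd m) g ⟩
        combination (λ i → half m i ℕ.+ half m i) g +ᴹ combination (odd m) g
          ≈⟨ +ᴹ-congʳ (combination-+ (half m) (half m) g) ⟩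
        (combination (half m) g +ᴹ combination (half m) g) +ᴹ combination (odd m) g ∎

    -- Linear independence of the classes in L/2L over the field with two elements.
    Independent : ∀ {r} → (Fin r → Carrierᴹ) → Set _
    Independent g = ∀ c → Doubled (combination c g) → ∀ i → 2 ∣ c i

    -- With more than d vectors, `coincidence` yields two different combinations with equal value,
    -- and `halve` makes of them a dependence modulo 2L.
    independent⇒≤d : ∀ {r} {g : Fin r → Carrierᴹ} → (∀ i → L (g i)) → Independent g → r ℕ.≤ d
    independent⇒≤d {zero}  g∈L indep = z≤n
    independent⇒≤d {suc r} {g} g∈L indep = ℕ.≰⇒> λ d≤r →
      let k , m , m′ , m≢m′ , eq = coincidence d≤r g g∈L
          c , ¬even , doubled = halve g g∈L k (toℕ ∘ m) (toℕ ∘ m′) 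
            (λ i → Fin.toℕ<n (m i)) (λ i → Fin.toℕ<n (m′ i))
            (λ h → m≢m′ λ i → Fin.toℕ-injective (h i)) eq
      in ¬even (indep c doubled)

    -- An odd coefficient of u could be reduced to 1 and would express u by g modulo 2L. So it is
    -- even and drops out, leaving a relation on g.
    independent-∷ : ∀ {r u} {g : Fin r → Carrierᴹ} → L u → Independent g →
      ¬ (∃[ c ] Doubled (u +ᴹ combination c g)) → Independent (u ∷ᵛ g)
    independent-∷ {r} {u} {g} u∈L indep new c doubled =
      λ { zero → c₀-even ; (suc i) → indep (c ∘ suc) tail-doubled i }
      where
      h = c zero / 2
      c₀u : c zero · u ≈ᴹ (c zero % 2) · u +ᴹ (h · u +ᴹ h · u)
      c₀u = ≈ᴹ-trans (·-congˡ (n≡n%2+n/2+n/2 (c zero)))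
        (≈ᴹ-trans (·-homo-+ u (c zero % 2) (h ℕ.+ h)) (+ᴹ-congˡ (·-homo-+ u h h)))
      reduced : Doubled ((c zero % 2) · u +ᴹ combination (c ∘ suc) g)
      reduced = doubled-cancelʳ (doubled-resp (≈ᴹ-trans (+ᴹ-congʳ c₀u)
        (MonoidSolver.solve 3 (λ a b c → (a ⊕ b) ⊕ c ⊜ (a ⊕ c) ⊕ b) ≈ᴹ-refl _ _ _)) doubled)
            (doubled-self (·-closed h u∈L))
      c₀-even : 2 ∣ c zero
      c₀-even with n%2≡0⊎1 (c zero)
      ... | inj₁ eq = m%n≡0⇒n∣m (c zero) 2 eq
      ... | inj₂ eq = ⊥-elim (new (c ∘ suc ,
          doubled-resp (+ᴹ-congʳ (≈ᴹ-trans (·-congˡ eq) (+ᴹ-identityʳ u))) reduced))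
      tail-doubled : Doubled (combination (c ∘ suc) g)
      tail-doubled = doubled-resp (≈ᴹ-trans (+ᴹ-congʳ (·-congˡ (n∣m⇒m%n≡0 (c zero) 2 c₀-even)))
          (+ᴹ-identityˡ _)) reduced

    -- The classes of the v i in coordinates over the field with two elements. `rank≤d` is what
    -- limits them to 2^d classes; the sum in `congruent` serves as a difference.
    record CoordinatesMod2 {n} (v : Fin n → Carrierᴹ) : Set (c ⊔ ℓ ⊔ p) where
      field
        rank        : ℕ
        rank≤d      : rank ℕ.≤ d
        generator   : Fin rank → Carrierᴹ
        generator∈L : ∀ i → L (generator i)
        independent : Independent generator
        coefficient : Fin n → Fin rank → ℕ
        congruent   : ∀ i → Doubled (v i +ᴹ combination (coefficient i) generator)

    -- Dependence modulo 2 of a lattice vector on others is not decidable, hence the double negation.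
    coordinatesMod2 : ∀ {n} (v : Fin n → Carrierᴹ) → (∀ i → L (v i)) → ¬ ¬ CoordinatesMod2 v
    coordinatesMod2 {zero}  v v∈L k = k record
      { rank = 0
      ; rank≤d = z≤n
      ; generator = λ ()
      ; generator∈L = λ ()
      ; independent = λ _ _ ()
      ; coefficient = λ ()
      ; congruent = λ ()
      }
    coordinatesMod2 {suc n} v v∈L k = coordinatesMod2 (v ∘ suc) (v∈L ∘ suc) λ K →
      let open CoordinatesMod2 K
          -- The goal is ⊥: a dependence of `v zero` on the generators would be passed to `k` at
          -- once, so in what follows `v zero` may be adjoined as a new generator.
          new : ¬ (∃[ c ] Doubled (v zero +ᴹ combination c generator))
          new (c , doubled) = k record
            { rank = rank
            ; rank≤d = rank≤d
            ; generator = generator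
            ; generator∈L = generator∈L
            ; independent = independent
            ; coefficient = c ∷ᵛ coefficient
            ; congruent = λ { zero → doubled ; (suc i) → congruent i }
            }
          g∈L : ∀ i → L ((v zero ∷ᵛ generator) i)
          g∈L = λ { zero → v∈L zero ; (suc i) → generator∈L i }
          indep = independent-∷ (v∈L zero) independent new
      in k record
        { rank = suc rank
        ; rank≤d = independent⇒≤d g∈L indep
        ; generator = v zero ∷ᵛ generator
        ; generator∈L = g∈L
        ; independent = indep
        ; coefficient = (1 ∷ᵛ λ _ → 0) ∷ᵛ λ i → 0 ∷ᵛ coefficient i
        ; congruent = λ
          { zero → doubled-resp (+ᴹ-congˡ
              (≈ᴹ-sym (≈ᴹ-trans (+ᴹ-cong (+ᴹ-identityʳ (v zero)) (SumV.sum-replicate-zero rank))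
              (+ᴹ-identityʳ (v zero))))) (doubled-self (v∈L zero))
          ; (suc i) → doubled-resp (+ᴹ-congˡ (≈ᴹ-sym (+ᴹ-identityˡ _))) (congruent i) }
        }

-- Sum-free sets modulo 2 and matchings

module SumFree {r : ℕ} where
  open import Data.Nat.Base using (_+_; _≤_)

  -- A function stands for its class in (Z/2)^r: `Even x` says that the class is 0, and
  -- `Even (x ⊞ y)` that x and y have the same class.
  Even : (Fin r → ℕ) → Set
  Even x = ∀ a → 2 ∣ x a

  infixl 6 _⊞_
  _⊞_ : (Fin r → ℕ) → (Fin r → ℕ) → Fin r → ℕ
  (x ⊞ y) a = x a + y a

  even-cancelˡ : ∀ x {y} → Even (x ⊞ y) → Even x → Even y
  even-cancelˡ x p q a = ∣m+n∣m⇒∣n (p a) (q a)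

  module _ {M} (X : Fin (suc M) → Fin r → ℕ)
    (2^r≤2M : 2 ^ r ≤ M + M)
    (nonzero : ∀ i → ¬ Even (X i))
    (distinct : ∀ {i j} → i Fin.< j → ¬ Even (X i ⊞ X j))
    (sum-free : ∀ i j l → ¬ Even (X (suc i) ⊞ X (suc j) ⊞ X (suc l))) where

    distinct-≢ : ∀ {i j} → Even (X i ⊞ X j) → i ≡ j
    distinct-≢ {i} {j} even with Fin.<-cmp i j
    ... | tri< i<j _ _ = ⊥-elim (distinct i<j even)
    ... | tri≈ _ i≡j _ = i≡j
    ... | tri> _ _ j<i = ⊥-elim (distinct j<i (λ a → subst (2 ∣_) (ℕ.+-comm (X i a) (X j a))
        (even a)))

    -- T = {X (suc j)} and its translate by X (suc i) are disjoint, hence cover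
    -- the 2^r classes; the class of X zero is not in T.
    partner : ∀ i → ∃[ j ] Even (X zero ⊞ X (suc i) ⊞ X (suc j))
    partner i = search (pigeonhole-functions (s≤s 2^r≤2M) (λ k a → point k a mod 2))
      where
      point₂ : Fin M ⊎ Fin M → Fin r → ℕ
      point₂ = [ X ∘ suc , (λ j → X (suc i) ⊞ X (suc j)) ]′
      -- 2M + 1 points meet at most 2M classes. All but the first lie in different classes, so the
      -- collision involves `X zero`.
      point : Fin (suc (M + M)) → Fin r → ℕ
      point zero    = X zero
      point (suc k) = point₂ (splitAt M k)
      ≡⇒even : ∀ x y → (∀ a → x a mod 2 ≡ y a mod 2) → Even (x ⊞ y)
      ≡⇒even x y same a = %2-≡⇒even-+ (x a) (y a) (Fin.fromℕ<-injective _ _ (m%n<n (x a) 2)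
          (m%n<n (y a) 2) (same a))
      point₂-injective : ∀ s t → Even (point₂ s ⊞ point₂ t) → s ≡ t
      point₂-injective (inj₁ j) (inj₁ j′) even = cong inj₁ (Fin.suc-injective (distinct-≢ even))
      point₂-injective (inj₂ j) (inj₂ j′) even =
          cong inj₂ (Fin.suc-injective (distinct-≢ (even-cancelˡ (X (suc i) ⊞ X (suc i))
        (λ a → subst (2 ∣_) (solve 3 (λ i j j′ → (i :+ j) :+ (i :+ j′) := (i :+ i) :+ (j :+ j′))
            refl (X (suc i) a) (X (suc j) a) (X (suc j′) a)) (even a))
        (λ a → 2∣n+n (X (suc i) a)))))
        where open +-*-Solver
      point₂-injective (inj₁ j) (inj₂ j′) even = ⊥-elim (sum-free j i j′ λ a →
        subst (2 ∣_) (sym (ℕ.+-assoc (X (suc j) a) (X (suc i) a) (X (suc j′) a))) (even a))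
      point₂-injective (inj₂ j) (inj₁ j′) even = ⊥-elim (sum-free i j j′ even)
      splitAt-injective : ∀ k k′ → splitAt M k ≡ splitAt M k′ → k ≡ k′
      splitAt-injective k k′ eq = trans (sym (Fin.join-splitAt M M k)) (trans (cong (join M M) eq)
          (Fin.join-splitAt M M k′))
      hit : ∀ s → Even (X zero ⊞ point₂ s) → ∃[ j ] Even (X zero ⊞ X (suc i) ⊞ X (suc j))
      hit (inj₁ j) even with () ← distinct-≢ {zero} {suc j} even
      hit (inj₂ j) even = j , λ a →
          subst (2 ∣_) (sym (ℕ.+-assoc (X zero a) (X (suc i) a) (X (suc j) a))) (even a)
      search : (∃₂ λ k k′ → k Fin.< k′ × (∀ a → point k a mod 2 ≡ point k′ a mod 2)) →
        ∃[ j ] Even (X zero ⊞ X (suc i) ⊞ X (suc j))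
      search (zero  , suc k′ , _ , same) =
          hit (splitAt M k′) (≡⇒even (X zero) (point₂ (splitAt M k′)) same)
      search (suc k , suc k′ , s≤s k<k′ , same) =
          ⊥-elim (Fin.<-irrefl (splitAt-injective k k′ (point₂-injective (splitAt M k)
          (splitAt M k′)
        (≡⇒even (point₂ (splitAt M k)) (point₂ (splitAt M k′)) same))) k<k′)

    -- For j the partner of i and k that of j, adding the two relations leaves x_k + x_i up to
    -- doubles, so k = i by distinctness.
    partner-involutive : ∀ i → proj₁ (partner (proj₁ (partner i))) ≡ i
    partner-involutive i = Fin.suc-injective
        (distinct-≢ (even-cancelˡ ((X zero ⊞ X (suc j)) ⊞ (X zero ⊞ X (suc j)))
      (λ a → subst (2 ∣_) (solve 4 (λ z i j k → (z :+ j :+ k) :+ (z :+ i :+ j) :=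
          ((z :+ j) :+ (z :+ j)) :+ (k :+ i)) refl
        (X zero a) (X (suc i) a) (X (suc j) a) (X (suc (proj₁ (partner j))) a))
            (∣m∣n⇒∣m+n (proj₂ (partner j) a) (proj₂ (partner i) a)))
      (λ a → 2∣n+n (X zero a + X (suc j) a))))
      where
      j = proj₁ (partner i)
      open +-*-Solver

    -- A fixed point would give x_0 + 2 x_i = 0 and hence x_0 = 0 modulo 2.
    partner-≢ : ∀ i → proj₁ (partner i) ≢ i
    partner-≢ i eq = nonzero zero (even-cancelˡ (X (suc i) ⊞ X (suc i))
      (λ a → subst (2 ∣_) (trans (cong (λ j → X zero a + X (suc i) a + X (suc j) a) eq)
         (solve 2 (λ z i → z :+ i :+ i := (i :+ i) :+ z) refl (X zero a) (X (suc i) a)))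
             (proj₂ (partner i) a))
      (λ a → 2∣n+n (X (suc i) a)))
      where open +-*-Solver

-- Involutions and partitions into pairs

module Matchings {M : ℕ} (R : Fin M → Fin M → Set) where
  open import Data.Nat.Base using (_+_; _≤_; _<_)

  record Matching : Set where
    field
      mate       : Fin M → Fin M
      involutive : ∀ i → mate (mate i) ≡ i
      related    : ∀ i → i Fin.< mate i × R i (mate i) ⊎ mate i Fin.< i × R (mate i) i

  -- The maps of `Fin M` to itself are finitely many, coded by `Fin (M ^ M)`, and validity of each
  -- is decidable, so a search decides whether a matching exists.
  matching-stable : (∀ i j → Dec (R i j)) → ¬ ¬ Matching → Matching
  matching-stable R? ¬¬matching = fromCode (decidable-stable (Fin.any? valid?) λ ¬valid →
      ¬¬matching (¬valid ∘ toCode))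
    where
    Valid : (Fin M → Fin M) → Set
    Valid f = ∀ i → f (f i) ≡ i × (i Fin.< f i × R i (f i) ⊎ f i Fin.< i × R (f i) i)
    valid? : ∀ x → Dec (Valid (finToFun {M} {M} x))
    valid? x = Fin.all? λ i → let j = finToFun {M} {M} x i in
      (finToFun x j Fin.≟ i) ×-dec ((i Fin.<? j ×-dec R? i j) ⊎-dec (j Fin.<? i ×-dec R? j i))
    fromCode : ∃[ x ] Valid (finToFun {M} {M} x) → Matching
    fromCode (x , valid) = record
      { mate = finToFun x ; involutive = proj₁ ∘ valid ; related = proj₂ ∘ valid }
    toCode : Matching → ∃[ x ] Valid (finToFun {M} {M} x)
    toCode m = funToFin mate , λ i →
        trans (cong (finToFun (funToFin mate)) (code i)) (trans (code (mate i)) (involutive i))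
      , subst (λ j → i Fin.< j × R i j ⊎ j Fin.< i × R j i) (sym (code i)) (related i)
      where
      open Matching m
      code : ∀ i → finToFun (funToFin mate) i ≡ mate i
      code = Fin.finToFun-funToFin mate

  module _ (m : Matching) where
    open Matching m

    mate-injective : ∀ {i j} → mate i ≡ mate j → i ≡ j
    mate-injective {i} {j} eq = trans (sym (involutive i)) (trans (cong mate eq) (involutive j))

    flatten : List (Fin M × Fin M) → List (Fin M)
    flatten = concatMap λ (i , j) → i ∷ j ∷ []

    -- Removing the head and its mate leaves a duplicate-free list closed under `mate`. The mate is
    -- cut out of the middle, so the recursion is on the length bound `k`.
    pairs : ∀ k (xs : List (Fin M)) → length xs ≤ k → Unique xs → (∀ {i} → i ∈ xs → mate i ∈ xs) →
      ∃[ ps ] (flatten ps ↭ xs × All (λ (i , j) → i Fin.< j × R i j) ps)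
    pairs k [] _ _ _ = [] , ↭-refl , []
    pairs (suc k) (x ∷ xs) (s≤s len) unique closed with related x
    ... | r with closed (here refl)
    ... | here eq = ⊥-elim ([ (λ (x< , _) → Fin.<-irrefl (sym eq) x<) ,
        (λ (<x , _) → Fin.<-irrefl eq <x) ]′ r)
    ... | there y∈xs with ∈-∃++ y∈xs
    ... | ys , zs , refl = orient r
      where
      rest = ys List.++ zs
      xs↭ : x ∷ ys List.++ mate x ∷ zs ↭ x ∷ mate x ∷ rest
      xs↭ = ↭-prep x (Perm.shift (mate x) ys zs)
      unique′ : Unique (x ∷ mate x ∷ rest)
      unique′ = PermSetoid.Unique-resp-↭ (≡.setoid (Fin M)) (Perm.↭⇒↭ₛ xs↭) unique
      closed′ : ∀ {i} → i ∈ rest → mate i ∈ rest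
      closed′ {i} i∈ with Perm.∈-resp-↭ xs↭ (closed (Perm.∈-resp-↭ (↭-sym xs↭) (there (there i∈))))
      ... | here eq = ⊥-elim (Unique[x∷xs]⇒x∉xs (tailU unique′)
          (subst (_∈ rest) (trans (sym (involutive i)) (cong mate eq)) i∈))
        where
        tailU : ∀ {x} {xs : List (Fin M)} → Unique (x ∷ xs) → Unique xs
        tailU (_ ∷ u) = u
      ... | there (here eq) = ⊥-elim (Unique[x∷xs]⇒x∉xs unique′
          (there (subst (_∈ rest) (mate-injective eq) i∈)))
      ... | there (there j∈) = j∈
      drop₂ : ∀ {x y} {xs : List (Fin M)} → Unique (x ∷ y ∷ xs) → Unique xs
      drop₂ (_ ∷ _ ∷ u) = u
      shorter : length rest ≤ k
      shorter = ℕ.≤-trans (ℕ.n≤1+n _) (subst (_≤ k) (Perm.↭-length (Perm.shift (mate x) ys zs)) len)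
      recursion = pairs k rest shorter (drop₂ unique′) closed′
      orient : x Fin.< mate x × R x (mate x) ⊎ mate x Fin.< x × R (mate x) x → _
      orient (inj₁ h) = let ps , perm , all = recursion in
        (x , mate x) ∷ ps , ↭-trans (↭-prep x (↭-prep (mate x) perm)) (↭-sym xs↭) , h ∷ all
      orient (inj₂ h) = let ps , perm , all = recursion in
        (mate x , x) ∷ ps , ↭-trans (↭-swap (mate x) x perm) (↭-sym xs↭) , h ∷ all

    -- If no i ≥ h is the smaller element of its pair, the mates of these h + 2
    -- elements are h + 2 distinct elements below h.
    large-smaller-element : ∀ h → M ≡ suc h + suc h →
        ∃[ i ] (h ≤ toℕ i × i Fin.< mate i × R i (mate i))
    large-smaller-element h refl with Fin.any? (λ i → h ℕ.≤? toℕ i ×-dec i Fin.<? mate i)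
    ... | yes (i , h≤i , i<mate) = i , h≤i , i<mate ,
          [ proj₂ , (λ (mate<i , _) → ⊥-elim (ℕ.<-asym i<mate mate<i)) ]′ (related i)
    ... | no none = ⊥-elim (collide (Fin.pigeonhole {h} {suc (suc h)} (ℕ.m<n⇒m<1+n ℕ.≤-refl) (λ k →
        fromℕ< (mate<h k))))
      where
      element : Fin (suc (suc h)) → Fin M
      element k = fromℕ< {h + toℕ k} (subst (h + toℕ k <_) (ℕ.+-suc h (suc h))
          (ℕ.+-monoʳ-< h (Fin.toℕ<n k)))
      toℕ-element : ∀ k → toℕ (element k) ≡ h + toℕ k
      toℕ-element k = Fin.toℕ-fromℕ< _
      mate<h : ∀ k → toℕ (mate (element k)) < h
      mate<h k = ℕ.≰⇒> λ h≤ → [ (λ (i< , _) →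
          none (element k , ℕ.≤-trans (ℕ.m≤m+n h (toℕ k)) (ℕ.≤-reflexive (sym (toℕ-element k))) ,
          i<))
        , (λ (<i , _) → none (mate (element k) , h≤ , subst (mate (element k) Fin.<_)
            (sym (involutive (element k))) <i)) ]′ (related (element k))
      collide : (∃₂ λ k k′ → k Fin.< k′ × fromℕ< (mate<h k) ≡ fromℕ< (mate<h k′)) → ⊥
      collide (k , k′ , k<k′ , eq) = Fin.<-irrefl (Fin.toℕ-injective (ℕ.+-cancelˡ-≡ h _ _
        (trans (sym (toℕ-element k))
            (trans (cong toℕ (mate-injective (Fin.toℕ-injective (Fin.fromℕ<-injective _ _ (mate<h k)
            (mate<h k′) eq)))) (toℕ-element k′))))) k<k′

  pairPartition : ∀ {S : ℕ → ℕ → Set} → (∀ {i j} → R i j → S (suc (toℕ i)) (suc (toℕ j))) →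
      Matching → PairPartition M S
  pairPartition {S} R⇒S m =
    let ps , perm , all = pairs m M (allFin M)
          (ℕ.≤-reflexive (List.length-tabulate {n = M} (λ i → i))) (allFin⁺ M) (λ _ → ∈-allFin _)
    in map index₂ ps
     , ↭-trans (↭-reflexive (flatten-index _ (λ _ _ → refl) ps))
         (↭-trans (Perm.map⁺ index perm) (↭-reflexive (trans (List.map-tabulate (λ i → i) index)
             (tabulate-applyUpTo M suc))))
     , relate all
    where
    index : Fin M → ℕ
    index i = suc (toℕ i)
    index₂ : Fin M × Fin M → ℕ × ℕ
    index₂ (i , j) = index i , index j
    -- `PairPartition` flattens by its own pattern lambda; the abstract `f` captures it through its
    -- values on pairs.
    flatten-index : ∀ (f : ℕ × ℕ → List ℕ) → (∀ i j → f (i , j) ≡ i ∷ j ∷ []) →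
      ∀ ps → concatMap f (map index₂ ps) ≡ map index (flatten m ps)
    flatten-index f f≡ []             = refl
    flatten-index f f≡ ((i , j) ∷ ps) = cong₂ List._++_ (f≡ (index i) (index j))
        (flatten-index f f≡ ps)
    tabulate-applyUpTo : ∀ n (f : ℕ → ℕ) → tabulate {n = n} (f ∘ toℕ) ≡ applyUpTo f n
    tabulate-applyUpTo zero    f = refl
    tabulate-applyUpTo (suc n) f = cong (f 0 ∷_) (tabulate-applyUpTo n (f ∘ suc))
    relate : ∀ {ps} → All (λ (i , j) → i Fin.< j × R i j) ps → All _ (map index₂ ps)
    relate []                = []
    relate ((i<j , r) ∷ all) = (s≤s i<j , R⇒S r) ∷ relate all

-- Approximation modulo 2

module Approximation {A : ArchimedeanOrderedRing} {c ℓ} (E : EuclideanModule A c ℓ)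
  {p} {L : Euclidean.Carrierᴹ E → Set p} (Λ : IsDiscreteSubgroup E L)
  (α : Euclidean.Carrierᴹ E) where
  open Euclidean E
  open DiscreteSubgroup E Λ

  error : ℕ → Carrierᴹ → Carrierᴹ
  error q v = q · α -ᴹ v

  error-+ : ∀ q r u v → error (q ℕ.+ r) (u +ᴹ v) ≈ᴹ error q u +ᴹ error r v
  error-+ q r u v = ≈ᴹ-trans (+ᴹ-cong (·-homo-+ α q r) (≈ᴹ-sym (-ᴹ-+ᴹ-comm u v)))
    (MonoidSolver.solve 4 (λ q r u v → (q ⊕ r) ⊕ (u ⊕ v) ⊜ (q ⊕ u) ⊕ (r ⊕ v)) ≈ᴹ-refl (q · α)
        (r · α) (-ᴹ u) (-ᴹ v))

  error-cong : ∀ {q r u v} → q ≡ r → u ≈ᴹ v → error q u ≈ᴹ error r v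
  error-cong q≡r u≈v = +ᴹ-cong (·-congˡ q≡r) (-ᴹ‿cong u≈v)

  BoundedBelow : ℕ → Carrier → Set _
  BoundedBelow r s = ∀ {m v} → 1 ℕ.≤ m → m ℕ.< r → L v → s ≤ N (error m v)

  x≈y+z⇒x-y≈z : ∀ {x y z} → x ≈ᴹ y +ᴹ z → x -ᴹ y ≈ᴹ z
  x≈y+z⇒x-y≈z {x} {y} {z} eq = ≈ᴹ-trans (+ᴹ-congʳ (≈ᴹ-trans eq (+ᴹ-comm y z))) (x+y-y≈x y z)

  four-mono-≤ : ∀ {x y} → x ≤ y → four x ≤ four y
  four-mono-≤ h = +-mono-≤ (+-mono-≤ h h) (+-mono-≤ h h)

  -- Half of the difference of two approximations in the same class modulo 2
  -- is itself an approximation.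
  difference-bound : ∀ {r s Q Q′ P P′} → BoundedBelow r s → Q′ ℕ.< Q → Q ℕ.< Q′ ℕ.+ (r ℕ.+ r) →
    L P′ → 2 ∣ Q ℕ.+ Q′ → Doubled (P +ᴹ P′) → four s ≤ N (error Q P -ᴹ error Q′ P′)
  difference-bound {r} {s} {Q} {Q′} {P} {P′} below Q′<Q Q< P′∈L even (w , w∈L , eq) = ≤-resp ≈-refl
    (≈-sym (≈-trans (N-cong (x≈y+z⇒x-y≈z (≈ᴹ-trans (error-cong Q≡ P≈)
      (≈ᴹ-trans (error-+ Q′ (m ℕ.+ m) P′ (v +ᴹ v)) (+ᴹ-congˡ (error-+ m m v v))))))
          (N-double (error m v))))
    (four-mono-≤ (below 1≤m m<r (+-closed w∈L (neg-closed P′∈L))))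
    where
    -- From P + P′ = 2w follows P - P′ = 2 (w - P′).
    v = w -ᴹ P′
    k = Q ℕ.∸ Q′
    Q≡′ : Q ≡ Q′ ℕ.+ k
    Q≡′ = sym (ℕ.m+[n∸m]≡n (ℕ.<⇒≤ Q′<Q))
    2∣k : 2 ∣ k
    2∣k = ∣m+n∣m⇒∣n (subst (2 ∣_) (trans (cong (ℕ._+ Q′) Q≡′)
        (solve 2 (λ q k → (q :+ k) :+ q := (q :+ q) :+ k) refl Q′ k)) even) (2∣n+n Q′)
      where open +-*-Solver
    m = _∣_.quotient 2∣k
    k≡ : k ≡ m ℕ.+ m
    k≡ = trans (_∣_.equality 2∣k) (trans (ℕ.*-comm m 2) (cong (m ℕ.+_) (ℕ.+-identityʳ m)))
    Q≡ : Q ≡ Q′ ℕ.+ (m ℕ.+ m)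
    Q≡ = trans Q≡′ (cong (Q′ ℕ.+_) k≡)
    1≤m : 1 ℕ.≤ m
    1≤m = ℕ.n≢0⇒n>0 λ m≡0 → ℕ.<⇒≢ Q′<Q
        (sym (trans Q≡ (trans (cong (λ m → Q′ ℕ.+ (m ℕ.+ m)) m≡0) (ℕ.+-identityʳ Q′))))
    m<r : m ℕ.< r
    m<r = ℕ.≰⇒> λ r≤m → ℕ.<⇒≱ Q< (subst (Q′ ℕ.+ (r ℕ.+ r) ℕ.≤_) (sym Q≡)
        (ℕ.+-monoʳ-≤ Q′ (ℕ.+-mono-≤ r≤m r≤m)))
    P≈ : P ≈ᴹ P′ +ᴹ (v +ᴹ v)
    P≈ = ≈ᴹ-sym (begin
      P′ +ᴹ ((w -ᴹ P′) +ᴹ (w -ᴹ P′))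
        ≈⟨ MonoidSolver.solve 3 (λ p w n → p ⊕ ((w ⊕ n) ⊕ (w ⊕ n)) ⊜ (((w ⊕ w) ⊕ n) ⊕ p) ⊕ n)
            ≈ᴹ-refl P′ w (-ᴹ P′) ⟩
      (w +ᴹ w) -ᴹ P′ +ᴹ P′ -ᴹ P′     ≈⟨ x+y-y≈x P′ _ ⟩
      (w +ᴹ w) -ᴹ P′                 ≈⟨ +ᴹ-congʳ eq ⟨
      (P +ᴹ P′) -ᴹ P′                ≈⟨ x+y-y≈x P′ P ⟩
      P ∎)
      where open SetoidReasoning ≈ᴹ-setoid

  N-swap : ∀ u v → N (u -ᴹ v) ≈ N (v -ᴹ u)
  N-swap u v = ≈-trans (≈-sym (N-neg (u -ᴹ v)))
    (N-cong (≈ᴹ-trans (≈ᴹ-sym (-ᴹ-+ᴹ-comm u (-ᴹ v))) (≈ᴹ-trans (+ᴹ-congˡ (-ᴹ-involutive v))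
        (+ᴹ-comm _ _))))

  -- The parallelogram law for (a ± b) ± c and then for a ± b gives equality once N (a + b + c) is
  -- added on the left; that term is nonnegative.
  sign-sum : ∀ a b c →
    N (a -ᴹ (b +ᴹ c)) + N ((a +ᴹ c) -ᴹ b) + N ((a +ᴹ b) -ᴹ c) ≤
    four (N a) + four (N b) + four (N c)
  sign-sum a b c = ≤-resp ≈-refl identity (x≤x+nonNeg (⟨⟩-nonNeg ((a +ᴹ b) +ᴹ c)))
    where
    open SetoidReasoning setoid
    n₁ = N (a -ᴹ b)
    n₂ = N (a +ᴹ b)
    identity : N (a -ᴹ (b +ᴹ c)) + N ((a +ᴹ c) -ᴹ b) + N ((a +ᴹ b) -ᴹ c) + N ((a +ᴹ b) +ᴹ c)
             ≈ four (N a) + four (N b) + four (N c)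
    identity = begin
      N (a -ᴹ (b +ᴹ c)) + N ((a +ᴹ c) -ᴹ b) + N ((a +ᴹ b) -ᴹ c) + N ((a +ᴹ b) +ᴹ c)
        ≈⟨ +-congʳ (+-congʳ (+-cong
             (N-cong (≈ᴹ-trans (+ᴹ-congˡ (≈ᴹ-sym (-ᴹ-+ᴹ-comm b c)))
                 (≈ᴹ-sym (+ᴹ-assoc a (-ᴹ b) (-ᴹ c)))))
             (N-cong (MonoidSolver.solve 3 (λ a b c → (a ⊕ c) ⊕ b ⊜ (a ⊕ b) ⊕ c) ≈ᴹ-refl a
                 (-ᴹ b) c)))) ⟩
      N ((a -ᴹ b) -ᴹ c) + N ((a -ᴹ b) +ᴹ c) + N ((a +ᴹ b) -ᴹ c) + N ((a +ᴹ b) +ᴹ c)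
        ≈⟨ S.solve 4 (λ w x y z → w S.:+ x S.:+ y S.:+ z S.:= (x S.:+ w) S.:+ (z S.:+ y)) ≈-refl _ _
            _ _ ⟩
      (N ((a -ᴹ b) +ᴹ c) + N ((a -ᴹ b) -ᴹ c)) + (N ((a +ᴹ b) +ᴹ c) + N ((a +ᴹ b) -ᴹ c))
        ≈⟨ +-cong (parallelogram (a -ᴹ b) c) (parallelogram (a +ᴹ b) c) ⟩
      ((n₁ + n₁) + (N c + N c)) + ((n₂ + n₂) + (N c + N c))
        ≈⟨ S.solve 3 (λ x y c → ((x S.:+ x) S.:+ (c S.:+ c)) S.:+ ((y S.:+ y) S.:+ (c S.:+ c))
             S.:= ((y S.:+ x) S.:+ (y S.:+ x)) S.:+ ((c S.:+ c) S.:+ (c S.:+ c))) ≈-refl n₁ n₂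
                 (N c) ⟩
      ((n₂ + n₁) + (n₂ + n₁)) + four (N c)
        ≈⟨ +-congʳ (+-cong (parallelogram a b) (parallelogram a b)) ⟩
      (((N a + N a) + (N b + N b)) + ((N a + N a) + (N b + N b))) + four (N c)
        ≈⟨ +-congʳ (S.solve 2 (λ x y → (x S.:+ y) S.:+ (x S.:+ y) S.:= (x S.:+ x) S.:+ (y S.:+ y))
            ≈-refl (N a + N a) (N b + N b)) ⟩
      four (N a) + four (N b) + four (N c) ∎

  -- Q i is q_{n+i}, P i is a lattice point nearest to q_{n+i} α, and Q₁ is q_{n+1}.
  record Approximations (M : ℕ) : Set (c ⊔ ℓ ⊔ p) where
    field
      Q          : Fin (suc M) → ℕ
      P          : Fin (suc M) → Carrierᴹ
      P∈L        : ∀ i → L (P i)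
      Q-mono     : ∀ {i j} → i Fin.< j → Q i ℕ.< Q j
      Q₁         : ℕ
      Q₁≤Q       : ∀ i → Q₁ ℕ.≤ Q (suc i)
      Q<2Q₁      : ∀ i → Q i ℕ.< Q₁ ℕ.+ Q₁
      1≤Q        : ∀ i → 1 ℕ.≤ Q i
      best       : ∀ i → BoundedBelow (Q i) (N (error (Q i) (P i)))
      best₀      : BoundedBelow Q₁ (N (error (Q zero) (P zero)))
      decreasing : ∀ i → N (error (Q (suc i)) (P (suc i))) < N (error (Q zero) (P zero))
      positive   : 0# < N (error (Q zero) (P zero))

  module _ {M} (approximations : Approximations M) where
    open Approximations approximations

    e : Fin (suc M) → Carrierᴹ
    e i = error (Q i) (P i)

    σ₀ : Carrier
    σ₀ = N (e zero)

    σ≤σ₀ : ∀ i → N (e i) ≤ σ₀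
    σ≤σ₀ zero    = ≤-refl
    σ≤σ₀ (suc i) = <⇒≤ (decreasing i)

    σ<σ₀ : ∀ {i j : Fin (suc M)} → i Fin.< j → N (e j) < σ₀
    σ<σ₀ {j = suc j} _ = decreasing j

    σ₀<fourσ₀ : σ₀ < four σ₀
    σ₀<fourσ₀ = <-respˡ (+-identityʳ σ₀)
        (+-mono-<-≤ (<-respˡ (+-identityʳ σ₀) (+-monoʳ-< σ₀ positive)) (+-nonNeg (<⇒≤ positive)
        (<⇒≤ positive)))

    four-mono-< : ∀ {x y} → x < y → four x < four y
    four-mono-< h = +-mono-< (+-mono-< h h) (+-mono-< h h)

    -- `difference-bound` against the pair (0, 0) gives 4 σ₀ ≤ N (e i) ≤ σ₀, impossible for σ₀ > 0.
    nonzero : ∀ i → 2 ∣ Q i → Doubled (P i) → ⊥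
    nonzero i even doubled = <-irrefl ≈-refl (<-≤-trans σ₀<fourσ₀ (≤-trans
      (difference-bound best₀ (1≤Q i) (Q<2Q₁ i) 0-closed
        (subst (2 ∣_) (sym (ℕ.+-identityʳ (Q i))) even) (doubled-resp (≈ᴹ-sym (+ᴹ-identityʳ (P i)))
            doubled))
      (≤-resp (N-cong (≈ᴹ-sym (x≈y+z⇒x-y≈z
          (≈ᴹ-sym (≈ᴹ-trans (+ᴹ-congʳ (-ᴹ‿inverseʳ 0ᴹ)) (+ᴹ-identityˡ (e i))))))) ≈-refl (σ≤σ₀ i))))

    -- 4 σ₀ ≤ N (e j - e i) ≤ 2 N (e j) + 2 N (e i) < 4 σ₀, strictly because j is not the initial
    -- index.
    distinct : ∀ {i j} → i Fin.< j → 2 ∣ Q i ℕ.+ Q j → Doubled (P i +ᴹ P j) → ⊥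
    distinct {i} {j} i<j even doubled = <-irrefl ≈-refl (<-≤-trans
      (≤-<-trans (N--≤ (e j) (e i)) (+-mono-<-≤ (+-mono-< (σ<σ₀ i<j) (σ<σ₀ i<j))
          (+-mono-≤ (σ≤σ₀ i) (σ≤σ₀ i))))
      (difference-bound best₀ (Q-mono i<j) (ℕ.<-≤-trans (Q<2Q₁ j) (ℕ.m≤n+m _ (Q i))) (P∈L i)
        (subst (2 ∣_) (ℕ.+-comm (Q i) (Q j)) even) (doubled-resp (+ᴹ-comm (P i) (P j)) doubled)))

    module _ {i j l : Fin (suc M)} (i<j : i Fin.< j) (j<l : j Fin.< l)
      (even : 2 ∣ Q i ℕ.+ Q j ℕ.+ Q l) (doubled : Doubled (P i +ᴹ P j +ᴹ P l)) where
      open +-*-Solver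

      private
        even-resp : ∀ {n} → Q i ℕ.+ Q j ℕ.+ Q l ≡ n → 2 ∣ n
        even-resp eq = subst (2 ∣_) eq even

      -- The four vectors e l ± e j ± e i have squared norms summing to
      -- 4 (N (e l) + N (e j) + N (e i)); halves of three of them are approximations.
      no-third-bound : ¬ four σ₀ ≤ N (e l -ᴹ (e j +ᴹ e i))
      no-third-bound bound₁ = <-irrefl ≈-refl
          (<-≤-trans upper′ (≤-trans (+-mono-≤ (+-mono-≤ bound₁ bound₂) bound₃)
          (sign-sum (e l) (e j) (e i))))
        where
        bound₂ : four σ₀ ≤ N ((e l +ᴹ e i) -ᴹ e j)
        bound₂ = ≤-resp ≈-refl (N-cong (+ᴹ-congʳ (error-+ (Q l) (Q i) (P l) (P i))))
          (difference-bound best₀ (ℕ.<-≤-trans (Q-mono j<l) (ℕ.m≤m+n (Q l) (Q i)))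
            (subst (Q l ℕ.+ Q i ℕ.<_) (ℕ.+-comm (Q₁ ℕ.+ Q₁) (Q j))
                (ℕ.+-mono-< (Q<2Q₁ l) (Q-mono i<j))) (P∈L j)
            (even-resp (solve 3 (λ i j l → i :+ j :+ l := (l :+ i) :+ j) refl (Q i) (Q j) (Q l)))
            (doubled-resp (MonoidSolver.solve 3 (λ i j l → (i ⊕ j) ⊕ l ⊜ (l ⊕ i) ⊕ j) ≈ᴹ-refl (P i)
                (P j) (P l)) doubled))
        -- Half of q_l + q_j - q_i need not be below `Q₁`, but it is below q_l as q_j < q_l. The
        -- weaker bound 4 N (e l) obtained from `best l` is matched by the same term on the other
        -- side of `sign-sum`.
        bound₃ : four (N (e l)) ≤ N ((e l +ᴹ e j) -ᴹ e i)
        bound₃ = ≤-resp ≈-refl (N-cong (+ᴹ-congʳ (error-+ (Q l) (Q j) (P l) (P j))))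
          (difference-bound (best l) (ℕ.<-≤-trans (Q-mono (ℕ.<-trans i<j j<l))
              (ℕ.m≤m+n (Q l) (Q j)))
            (ℕ.<-≤-trans (ℕ.+-monoʳ-< (Q l) (Q-mono j<l)) (ℕ.m≤n+m _ (Q i))) (P∈L i)
            (even-resp (solve 3 (λ i j l → i :+ j :+ l := (l :+ j) :+ i) refl (Q i) (Q j) (Q l)))
            (doubled-resp (MonoidSolver.solve 3 (λ i j l → (i ⊕ j) ⊕ l ⊜ (l ⊕ j) ⊕ i) ≈ᴹ-refl (P i)
                (P j) (P l)) doubled))
        upper′ : four (N (e l)) + four (N (e j)) + four (N (e i)) < four σ₀ + four σ₀ + four
            (N (e l))
        upper′ = <-resp (S.solve 3 (λ i j l → j S.:+ i S.:+ l S.:= l S.:+ j S.:+ i) ≈-refl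
            (four (N (e i))) (four (N (e j))) (four (N (e l)))) ≈-refl
          (+-monoˡ-< (four (N (e l))) (+-mono-<-≤ (four-mono-< (σ<σ₀ i<j)) (four-mono-≤ (σ≤σ₀ i))))

      -- If q_l and q_i + q_j differ, half of their distance is a positive denominator below `Q₁`,
      -- which yields the bound refuted by `no-third-bound`. Equality escapes because the
      -- half-difference then has denominator 0.
      triple : Q l ≡ Q i ℕ.+ Q j
      triple with ℕ.<-cmp (Q l) (Q j ℕ.+ Q i)
      ... | tri≈ _ eq _ = trans eq (ℕ.+-comm (Q j) (Q i))
      ... | tri< Q< _ _ = ⊥-elim (no-third-bound (≤-resp ≈-refl
              (≈-trans (N-cong (+ᴹ-congʳ (error-+ (Q j) (Q i) (P j) (P i)))) (N-swap _ _))
              (difference-bound best₀ Q< (ℕ.+-mono-< (Q-mono j<l) (Q<2Q₁ i)) (P∈L l)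
                (even-resp (cong (ℕ._+ Q l) (ℕ.+-comm (Q i) (Q j))))
                (doubled-resp (+ᴹ-congʳ (+ᴹ-comm (P i) (P j))) doubled))))
      ... | tri> _ _ Q> = ⊥-elim (no-third-bound (≤-resp ≈-refl
              (N-cong (+ᴹ-congˡ (-ᴹ‿cong (error-+ (Q j) (Q i) (P j) (P i)))))
              (difference-bound best₀ Q> (ℕ.<-≤-trans (Q<2Q₁ l) (ℕ.m≤n+m _ (Q j ℕ.+ Q i)))
                  (+-closed (P∈L j) (P∈L i))
                (even-resp (solve 3 (λ i j l → i :+ j :+ l := l :+ (j :+ i)) refl (Q i) (Q j)
                    (Q l)))
                (doubled-resp (MonoidSolver.solve 3 (λ i j l → (i ⊕ j) ⊕ l ⊜ l ⊕ (j ⊕ i)) ≈ᴹ-refl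
                    (P i) (P j) (P l)) doubled))))

    Triple : Fin (suc M) → Fin (suc M) → Fin (suc M) → Set _
    Triple i j l = 2 ∣ Q i ℕ.+ Q j ℕ.+ Q l × Doubled (P i +ᴹ P j +ᴹ P l)

    swap₁₂ : ∀ {i j l} → Triple i j l → Triple j i l
    swap₁₂ {i} {j} {l} (even , doubled) = subst (2 ∣_) (cong (ℕ._+ Q l) (ℕ.+-comm (Q i) (Q j))) even
        ,
      doubled-resp (+ᴹ-congʳ (+ᴹ-comm (P i) (P j))) doubled

    swap₂₃ : ∀ {i j l} → Triple i j l → Triple i l j
    swap₂₃ {i} {j} {l} (even , doubled) =
      subst (2 ∣_) (solve 3 (λ i j l → i :+ j :+ l := i :+ l :+ j) refl (Q i) (Q j) (Q l)) even ,
      doubled-resp (MonoidSolver.solve 3 (λ i j l → (i ⊕ j) ⊕ l ⊜ (i ⊕ l) ⊕ j) ≈ᴹ-refl (P i) (P j)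
          (P l)) doubled
      where open +-*-Solver

    ¬triple-repeated : ∀ {i l} → ¬ Triple i i l
    ¬triple-repeated {i} {l} (even , doubled) = nonzero l (∣m+n∣m⇒∣n even (2∣n+n (Q i)))
      (doubled-cancelʳ (doubled-resp (+ᴹ-comm _ _) doubled) (doubled-self (P∈L i)))

    -- With all three indices past the initial one, q_l = q_i + q_j would be at least 2 `Q₁`.
    ¬triple-increasing : ∀ {i j l} → i Fin.< j → j Fin.< l → ¬ Triple (suc i) (suc j) (suc l)
    ¬triple-increasing {i} {j} {l} i<j j<l (even , doubled) = ℕ.<⇒≱ (Q<2Q₁ (suc l))
      (ℕ.≤-trans (ℕ.+-mono-≤ (Q₁≤Q i) (Q₁≤Q j))
          (ℕ.≤-reflexive (sym (triple (s≤s i<j) (s≤s j<l) even doubled))))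

    ¬triple-< : ∀ {i j} → i Fin.< j → ∀ l → ¬ Triple (suc i) (suc j) (suc l)
    ¬triple-< {i} {j} i<j l t with Fin.<-cmp j l
    ... | tri< j<l _ _  = ¬triple-increasing i<j j<l t
    ... | tri≈ _ refl _ = ¬triple-repeated (swap₂₃ (swap₁₂ t))
    ... | tri> _ _ l<j with Fin.<-cmp i l
    ... | tri< i<l _ _  = ¬triple-increasing i<l l<j (swap₂₃ t)
    ... | tri≈ _ refl _ = ¬triple-repeated (swap₂₃ t)
    ... | tri> _ _ l<i  = ¬triple-increasing l<i i<j (swap₁₂ (swap₂₃ t))

    sum-free : ∀ i j l → ¬ Triple (suc i) (suc j) (suc l)
    sum-free i j l t with Fin.<-cmp i j
    ... | tri< i<j _ _  = ¬triple-< i<j l t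
    ... | tri≈ _ refl _ = ¬triple-repeated t
    ... | tri> _ _ j<i  = ¬triple-< j<i l (swap₁₂ t)

    SumPair : Fin M → Fin M → Set
    SumPair i j = Q (suc j) ≡ Q zero ℕ.+ Q (suc i)

    open Matchings SumPair using (Matching)

    matching : ∀ {d} (b : Fin d → Carrierᴹ) → (∀ v → ∃[ y ] v ≈ᴹ linearCombination y b) →
        2 ^ suc d ℕ.≤ M ℕ.+ M → ¬ ¬ Matching
    matching {d} b spanning 2^d≤M k = coordinatesMod2 b spanning P P∈L λ K → k (fromCoordinates K)
      where
      fromCoordinates : CoordinatesMod2 b spanning P → Matching
      fromCoordinates K = record { mate = proj₁ ∘ mates ; involutive =
          partner-involutive X 2^r≤2M nonzero′ distinct′ sum-free′ ; related = related }
        where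
        open CoordinatesMod2 K
        open SumFree {suc rank}
        -- The denominator's parity is the coordinate in front of those modulo 2L, so there are
        -- 2^(rank+1) ≤ 2M classes.
        X : Fin (suc M) → Fin (suc rank) → ℕ
        X i = Q i ∷ᵛ coefficient i
        reduce : ∀ {u c} → Doubled (u +ᴹ combination c generator) → (∀ a → 2 ∣ c a) → Doubled u
        reduce {c = c} doubled even =
            doubled-cancelʳ doubled (doubled-combination c generator∈L even)
        congruent-+ : ∀ {u v} c c′ → Doubled (u +ᴹ combination c generator) →
            Doubled (v +ᴹ combination c′ generator) →
          Doubled (u +ᴹ v +ᴹ combination (λ a → c a ℕ.+ c′ a) generator)
        congruent-+ {u} {v} c c′ p q = doubled-resp
          (≈ᴹ-trans (MonoidSolver.solve 4 (λ u v x y → (u ⊕ x) ⊕ (v ⊕ y) ⊜ (u ⊕ v) ⊕ (x ⊕ y))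
              ≈ᴹ-refl u v _ _)
            (+ᴹ-congˡ (≈ᴹ-sym (combination-+ c c′ generator)))) (doubled-+ p q)
        2^r≤2M : 2 ^ suc rank ℕ.≤ M ℕ.+ M
        2^r≤2M = ℕ.≤-trans (ℕ.^-monoʳ-≤ 2 (s≤s rank≤d)) 2^d≤M
        nonzero′ : ∀ i → ¬ Even (X i)
        nonzero′ i even = nonzero i (even zero) (reduce (congruent i) (even ∘ suc))
        distinct′ : ∀ {i j} → i Fin.< j → ¬ Even (X i ⊞ X j)
        distinct′ {i} {j} i<j even =
            distinct i<j (even zero) (reduce (congruent-+ (coefficient i) (coefficient j)
            (congruent i) (congruent j)) (even ∘ suc))
        toTriple : ∀ {i j l} → Even (X i ⊞ X j ⊞ X l) → Triple i j l
        toTriple {i} {j} {l} even = even zero ,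
            reduce (congruent-+ (λ a → coefficient i a ℕ.+ coefficient j a) (coefficient l)
            (congruent-+ (coefficient i) (coefficient j) (congruent i) (congruent j)) (congruent l))
            (even ∘ suc)
        sum-free′ : ∀ i j l → ¬ Even (X (suc i) ⊞ X (suc j) ⊞ X (suc l))
        sum-free′ i j l even = sum-free i j l (toTriple even)
        mates = partner X 2^r≤2M nonzero′ distinct′ sum-free′
        related : ∀ i → let j = proj₁ (mates i) in i Fin.< j × SumPair i j ⊎ j Fin.< i × SumPair j i
        related i = relate (proj₁ (mates i)) (proj₂ (mates i))
            (partner-≢ X 2^r≤2M nonzero′ distinct′ sum-free′ i)
          where
          relate : ∀ j → Even (X zero ⊞ X (suc i) ⊞ X (suc j)) → j ≢ i →
              i Fin.< j × SumPair i j ⊎ j Fin.< i × SumPair j i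
          relate j even j≢i with Fin.<-cmp i j
          ... | tri< i<j _ _ = 
            let e , t = toTriple {zero} {suc i} {suc j} even
            in inj₁ (i<j , triple (s≤s z≤n) (s≤s i<j) e t)
          ... | tri≈ _ i≡j _ = ⊥-elim (j≢i (sym i≡j))
          ... | tri> _ _ j<i = 
            let e , t = swap₂₃ (toTriple {zero} {suc i} {suc j} even)
            in inj₂ (j<i , triple (s≤s z≤n) (s≤s j<i) e t)

-- Best approximation denominators

open import Data.Nat.Base using (_+_; _*_; _⊓_; _≤_; _<_; _≥_; _>_)

module Norm {A : ArchimedeanOrderedRing} {c ℓ} (E : EuclideanModule A c ℓ)
  (‖_‖ : Euclidean.Carrierᴹ E → Euclidean.Carrier E)
  (‖‖-nonNeg : ∀ v → Euclidean._≤_ E (Euclidean.0# E) ‖ v ‖)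
  (‖‖-square : ∀ v → Euclidean._≈_ E (Euclidean._*_ E ‖ v ‖ ‖ v ‖) (Euclidean.N E v)) where
  open Euclidean E hiding (_≤_; _<_; _+_; _*_)
  open Euclidean E using () renaming (_≤_ to _≤ᴬ_; _<_ to _<ᴬ_; _*_ to _*ᴬ_)

  -- Suppose 0 < N v < ε². A norm below ε would make v vanish, against 0 < N v; hence ε ≤ ‖v‖, and
  -- squaring gives ε² ≤ N v. Tightness and definiteness convert the refutation into v = 0.
  square-discrete : ∀ {p} {L : Carrierᴹ → Set p} ε → 0# <ᴬ ε →
    (∀ v → L v → ‖ v -ᴹ 0ᴹ ‖ <ᴬ ε → v ≈ᴹ 0ᴹ) → ∀ v → L v → ¬ ε *ᴬ ε ≤ᴬ N v → v ≈ᴹ 0ᴹ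
  square-discrete ε 0<ε isolated v v∈L small = ⟨⟩-definite v (tight (⟨⟩-nonNeg v) λ 0<Nv →
      small λ Nv<ε² →
    <⇒¬≤ Nv<ε² (≤-resp ≈-refl N-v (square-mono-≤ (<⇒≤ 0<ε) λ ‖v‖<ε →
      <-irrefl (≈-sym (≈-trans (N-cong (isolated v v∈L ‖v‖<ε)) (⟨⟩-0ˡ 0ᴹ))) 0<Nv)))
    where
    <⇒¬≤ : ∀ {x y} → x <ᴬ y → ¬ y ≤ᴬ x
    <⇒¬≤ x<y y≤x = y≤x x<y
    N-v : ‖ v -ᴹ 0ᴹ ‖ *ᴬ ‖ v -ᴹ 0ᴹ ‖ ≈ N v
    N-v = ≈-trans (‖‖-square (v -ᴹ 0ᴹ)) (N-cong (x-0≈x v))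
      where
      x-0≈x : ∀ v → v -ᴹ 0ᴹ ≈ᴹ v
      x-0≈x v = ≈ᴹ-trans (+ᴹ-congʳ (≈ᴹ-sym (+ᴹ-identityʳ v))) (x+y-y≈x 0ᴹ v)

  module BestSequence {p} {L : Carrierᴹ → Set p} (Λ : IsDiscreteSubgroup E L) (α : Carrierᴹ)
    (ρ : ℕ → Carrier)
    (attained : ∀ m → 1 ≤ m → ∃[ v ] (L v × ρ m ≈ ‖ m · α -ᴹ v ‖))
    (lowerBound : ∀ m → 1 ≤ m → ∀ v → L v → ρ m ≤ᴬ ‖ m · α -ᴹ v ‖)
    (q : ℕ → ℕ) (n M : ℕ)
    (q-first : q 1 ≡ 1)
    (q-step : ∀ i → 1 ≤ i → i < n + M →
       IsMinimum (λ m → q i < m × ρ m <ᴬ ρ (q i)) (q (suc i))) where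
    open DiscreteSubgroup E Λ
    open Approximation E Λ α

    bound : ℕ
    bound = n + M

    ρ-nonNeg : ∀ m → 1 ≤ m → 0# ≤ᴬ ρ m
    ρ-nonNeg m 1≤m = ≤-resp ≈-refl (≈-sym (proj₂ (proj₂ (attained m 1≤m)))) (‖‖-nonNeg _)

    q-increasing : ∀ {i j} → 1 ≤ i → j ≤ bound → i < j → q i < q j
    q-increasing {i} {suc j} 1≤i j<bound i<1+j with ℕ.m≤n⇒m<n∨m≡n (ℕ.s≤s⁻¹ i<1+j)
    ... | inj₁ i<j  = ℕ.<-trans (q-increasing 1≤i (ℕ.<⇒≤ j<bound) i<j)
        (proj₁ (proj₁ (q-step j (ℕ.≤-trans 1≤i (ℕ.<⇒≤ i<j)) j<bound)))
    ... | inj₂ refl = proj₁ (proj₁ (q-step j 1≤i j<bound))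

    ρ-decreasing : ∀ {i j} → 1 ≤ i → j ≤ bound → i < j → ρ (q j) <ᴬ ρ (q i)
    ρ-decreasing {i} {suc j} 1≤i j<bound i<1+j with ℕ.m≤n⇒m<n∨m≡n (ℕ.s≤s⁻¹ i<1+j)
    ... | inj₁ i<j  = <-trans (proj₂ (proj₁ (q-step j (ℕ.≤-trans 1≤i (ℕ.<⇒≤ i<j)) j<bound)))
        (ρ-decreasing 1≤i (ℕ.<⇒≤ j<bound) i<j)
    ... | inj₂ refl = proj₂ (proj₁ (q-step j 1≤i j<bound))

    q-positive : ∀ {i} → 1 ≤ i → i ≤ bound → 1 ≤ q i
    q-positive {i} 1≤i i≤bound with ℕ.m≤n⇒m<n∨m≡n 1≤i
    ... | inj₁ 1<i  = ℕ.≤-trans (ℕ.≤-reflexive (sym q-first))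
        (ℕ.<⇒≤ (q-increasing ℕ.≤-refl i≤bound 1<i))
    ... | inj₂ refl = ℕ.≤-reflexive (sym q-first)

    -- Proved jointly with `ρ-minimal-next`, which extends the range up to the next denominator:
    -- between q_i and q_{i+1} nothing beats q_i by the minimality of q_{i+1}, and below q_i the
    -- induction applies.
    ρ-minimal : ∀ {i m} → 1 ≤ i → i ≤ bound → 1 ≤ m → m < q i → ρ (q i) ≤ᴬ ρ m
    ρ-minimal-next : ∀ {i m} → 1 ≤ i → i < bound → 1 ≤ m → m < q (suc i) → ρ (q i) ≤ᴬ ρ m
    ρ-minimal {suc zero}    _ _ 1≤m m<q = ⊥-elim (ℕ.<⇒≱ m<q (subst (_≤ _) (sym q-first) 1≤m))
    ρ-minimal {suc (suc i)} _ i<bound 1≤m m<q = ≤-trans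
      (<⇒≤ (proj₂ (proj₁ (q-step (suc i) (s≤s z≤n) i<bound)))) (ρ-minimal-next (s≤s z≤n) i<bound 1≤m
          m<q)
    ρ-minimal-next {i} {m} 1≤i i<bound 1≤m m<q with ℕ.<-cmp m (q i)
    ... | tri< m<qᵢ _ _ = ρ-minimal 1≤i (ℕ.<⇒≤ i<bound) 1≤m m<qᵢ
    ... | tri≈ _ refl _ = ≤-refl
    ... | tri> _ _ qᵢ<m = λ ρm<ρq → ℕ.<⇒≱ m<q (proj₂ (q-step i 1≤i i<bound) m (qᵢ<m , ρm<ρq))

    nearest : ℕ → Carrierᴹ
    -- A default value; `attained` speaks of positive denominators only.
    nearest zero    = 0ᴹ
    nearest (suc m) = proj₁ (attained (suc m) (s≤s z≤n))

    nearest∈L : ∀ m → L (nearest m)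
    nearest∈L zero    = 0-closed
    nearest∈L (suc m) = proj₁ (proj₂ (attained (suc m) (s≤s z≤n)))

    N-nearest : ∀ {m} → 1 ≤ m → ρ m *ᴬ ρ m ≈ N (error m (nearest m))
    N-nearest {suc m} _ = ≈-trans (*-cong eq eq) (‖‖-square _)
      where eq = proj₂ (proj₂ (attained (suc m) (s≤s z≤n)))

    N-minimal : ∀ {k m v} → 1 ≤ k → 1 ≤ m → ρ k ≤ᴬ ρ m → L v → N (error k (nearest k)) ≤ᴬ N
        (error m v)
    N-minimal {k} {m} {v} 1≤k 1≤m ρk≤ρm v∈L = ≤-resp (N-nearest 1≤k) (‖‖-square (error m v))
      (square-mono-≤ (ρ-nonNeg k 1≤k) (≤-trans ρk≤ρm (lowerBound m 1≤m v v∈L)))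

    N-decreasing : ∀ {k m} → 1 ≤ k → 1 ≤ m → ρ k <ᴬ ρ m → N (error k (nearest k)) <ᴬ N
        (error m (nearest m))
    N-decreasing {k} 1≤k 1≤m ρk<ρm = <-resp (N-nearest 1≤k) (N-nearest 1≤m)
        (square-mono-< (ρ-nonNeg k 1≤k) ρk<ρm)

    approximations : 1 ≤ n → 1 ≤ M → q (n + M) < q (n + 1) + q (n + 1) → Approximations M
    approximations 1≤n 1≤M q<2q = record
      { Q = Q
      ; P = λ i → nearest (Q i)
      ; P∈L = λ i → nearest∈L (Q i)
      ; Q-mono = λ {i} {j} i<j → q-increasing (1≤index i) (index≤ j) (ℕ.+-monoʳ-< n i<j)
      ; Q₁ = q (n + 1)
      ; Q₁≤Q = λ i → q-mono (1≤n+ 1) (index≤ (suc i)) (ℕ.+-monoʳ-≤ n (s≤s z≤n))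
      ; Q<2Q₁ = λ i → ℕ.≤-<-trans (q-mono (1≤index i) ℕ.≤-refl (index≤ i)) q<2q
      ; 1≤Q = 1≤Q
      ; best = λ i 1≤m m<Q → N-minimal (1≤Q i) 1≤m (ρ-minimal (1≤index i) (index≤ i) 1≤m m<Q)
      -- The range reaches up to q_{n+1}, which is why `ρ-minimal-next` enters here.
      ; best₀ = λ {m} 1≤m m<q → N-minimal (1≤Q zero) 1≤m (subst (λ i → ρ (q i) ≤ᴬ _)
          (sym (ℕ.+-identityʳ n))
          (ρ-minimal-next 1≤n n<bound 1≤m (subst (λ i → m < q i) (ℕ.+-comm n 1) m<q)))
      ; decreasing = λ i → N-decreasing (1≤Q (suc i)) (1≤Q zero) (ρ-decreasing (1≤index zero)
          (index≤ (suc i)) (ℕ.+-monoʳ-< n (s≤s z≤n)))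
      -- The error of q_n exceeds the later, nonnegative error of q_{n+M}.
      ; positive = ≤-<-trans (⟨⟩-nonNeg (error (q (n + M)) (nearest (q (n + M)))))
          (N-decreasing (q-positive (1≤n+ M) ℕ.≤-refl) (1≤Q zero)
            (ρ-decreasing (1≤index zero) ℕ.≤-refl (ℕ.+-monoʳ-< n 1≤M)))
      }
      where
      Q : Fin (suc M) → ℕ
      Q i = q (n + toℕ i)
      1≤n+ : ∀ k → 1 ≤ n + k
      1≤n+ k = ℕ.≤-trans 1≤n (ℕ.m≤m+n n k)
      1≤index : ∀ (i : Fin (suc M)) → 1 ≤ n + toℕ i
      1≤index i = 1≤n+ (toℕ i)
      index≤ : ∀ (i : Fin (suc M)) → n + toℕ i ≤ n + M
      index≤ i = ℕ.+-monoʳ-≤ n (Fin.toℕ≤pred[n] i)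
      n<bound : n < n + M
      n<bound = subst (_< n + M) (ℕ.+-identityʳ n) (ℕ.+-monoʳ-< n 1≤M)
      1≤Q : ∀ i → 1 ≤ Q i
      1≤Q i = q-positive (1≤index i) (index≤ i)
      q-mono : ∀ {i j} → 1 ≤ i → j ≤ n + M → i ≤ j → q i ≤ q j
      q-mono 1≤i j≤ i≤j with ℕ.m≤n⇒m<n∨m≡n i≤j
      ... | inj₁ i<j  = ℕ.<⇒≤ (q-increasing 1≤i j≤ i<j)
      ... | inj₂ refl = ℕ.≤-refl

    -- The relation is an equation in `ℕ`, hence decidable, so `matching-stable` removes the double
    -- negation.
    bestMatching : ∀ {d} (b : Fin d → Carrierᴹ) → (∀ v → ∃[ y ] v ≈ᴹ linearCombination y b) →
      1 ≤ n → 1 ≤ M → 2 ^ suc d ≤ M + M → q (n + M) < q (n + 1) + q (n + 1) →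
      Matchings.Matching {M} (λ i j → q (n + suc (toℕ j)) ≡ q (n + 0) + q (n + suc (toℕ i)))
    bestMatching b spanning 1≤n 1≤M 2^d≤M q<2q = Matchings.matching-stable _ (λ i j → _ ℕ.≟ _)
      (matching (approximations 1≤n 1≤M q<2q) b spanning 2^d≤M)

-- From `BestDenominator` to consecutive minima

¬BestDenominator-0 : ∀ {ρ q} → ¬ BestDenominator ρ 0 q
¬BestDenominator-0 ()

BestDenominator-unique : ∀ {ρ n x y} → BestDenominator ρ n x → BestDenominator ρ n y → x ≡ y
BestDenominator-unique first first = refl
BestDenominator-unique first (next z _) = ⊥-elim (¬BestDenominator-0 z)
BestDenominator-unique (next z _) first = ⊥-elim (¬BestDenominator-0 z)
BestDenominator-unique (next x (Px , x-min)) (next y (Py , y-min)) with BestDenominator-unique x y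
... | refl = ℕ.≤-antisym (x-min _ Py) (y-min _ Px)

-- Uniqueness identifies the predecessor hidden inside `next` with the given x.
BestDenominator-step : ∀ {ρ n x y} → BestDenominator ρ n x → BestDenominator ρ (suc n) y →
  IsMinimum (λ k → x < k × ρ k <ᴿ ρ x) y
BestDenominator-step x∈ first = ⊥-elim (¬BestDenominator-0 x∈)
BestDenominator-step x∈ (next z∈ min) with BestDenominator-unique x∈ z∈
... | refl = min

theorem1p4 : ∀ {c ℓ p : Level} (d : ℕ) → d ≥ 1 →
    (V : InnerProductSpace c ℓ) → HasDimension V d →
    (L : InnerProductSpace.Carrierᴹ V → Set p) → IsFullRankLattice V L →
    (α : InnerProductSpace.Carrierᴹ V) →
    (ρ : ℕ → ℝ) → IsDistanceToLattice V L α ρ →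
    (q : ℕ → ℕ) → let M = 2 ^ d in
    (n : ℕ) → n ≥ 1 →
    (∀ i → 1 ≤ i → i ≤ n + M → BestDenominator ρ i (q i)) →
    ( q (n + M) ≥ 2 * q (n + 1)
    ⊎ PairPartition M (λ j k → q (n + k) ≡ q n + q (n + j)) )
    ×
    ( q (n + M) ≥ (2 * q (n + 1)) ⊓ (q n + q (n + M / 2))
    × (2 * q (n + 1)) ⊓ (q n + q (n + M / 2)) ≥ q n + q (n + 1)
    × q n + q (n + 1) > 2 * q n )
-- From here on `d` is one less than the dimension, so `M / 2` is `2 ^ d`.
theorem1p4 {c} {ℓ} (suc d) _ V (b , basis) L lattice α ρ distance q n 1≤n best =
  proj₁ alternatives , proj₂ alternatives , lower , strict
  where
  open InnerProductSpace V hiding (_×_)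
  open IsFullRankLattice lattice using (resp; 0-closed; +-closed; neg-closed; discrete)
  open IsDistanceToLattice distance
  M = 2 ^ suc d
  E : EuclideanModule ℝ-archimedean c ℓ
  E = record
    { underlyingModule = vectorSpace
    ; ⟨_,_⟩ = ⟨_,_⟩
    ; ⟨⟩-cong = ⟨⟩-cong
    ; ⟨⟩-sym = ⟨⟩-sym
    ; ⟨⟩-+ˡ = ⟨⟩-+ˡ
    ; ⟨⟩-*ˡ = ⟨⟩-*ˡ
    ; ⟨⟩-nonNeg = ⟨⟩-nonNeg
    ; ⟨⟩-definite = ⟨⟩-definite
    }
  module Nm = Norm E ‖_‖ ‖‖-nonNeg ‖‖-square
  Λ : IsDiscreteSubgroup E L
  Λ = record
    { resp = resp
    ; 0-closed = 0-closed
    ; +-closed = +-closed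
    ; neg-closed = neg-closed
    ; discrete = let ε , 0<ε , isolated = discrete 0ᴹ 0-closed in
        ε *ᴿ ε ,
        ArchimedeanOrderedRing.*-pos ℝ-archimedean {ε} {ε} 0<ε 0<ε ,
        Nm.square-discrete {L = L} ε 0<ε isolated
    }
  1≤2^d : 1 ≤ 2 ^ d
  1≤2^d = ℕ.m^n>0 2 d
  2^d≤M : 2 ^ d ≤ M
  2^d≤M = ℕ.m≤m+n (2 ^ d) _
  1≤M : 1 ≤ M
  1≤M = ℕ.≤-trans 1≤2^d 2^d≤M
  M/2 : M / 2 ≡ 2 ^ d
  M/2 = trans (cong (_/ 2) (ℕ.*-comm 2 (2 ^ d))) (m*n/n≡m (2 ^ d) 2)
  open Nm.BestSequence Λ α ρ attained lowerBound q n M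
    (BestDenominator-unique (best 1 ℕ.≤-refl (ℕ.≤-trans 1≤n (ℕ.m≤m+n n M))) first)
    (λ i 1≤i i<n+M → BestDenominator-step (best i 1≤i (ℕ.<⇒≤ i<n+M)) (best (suc i) (s≤s z≤n) i<n+M))
    using (q-increasing; bestMatching)
  q-mono : ∀ {i j} → i ≤ j → j ≤ M → q (n + i) ≤ q (n + j)
  q-mono {i} {j} i≤j j≤M with ℕ.m≤n⇒m<n∨m≡n i≤j
  ... | inj₁ i<j  = ℕ.<⇒≤ (q-increasing (ℕ.≤-trans 1≤n (ℕ.m≤m+n n i))
      (ℕ.+-monoʳ-≤ n j≤M) (ℕ.+-monoʳ-< n i<j))
  ... | inj₂ refl = ℕ.≤-refl
  q<q : q n < q (n + 1)
  q<q = q-increasing 1≤n (ℕ.+-monoʳ-≤ n 1≤M) (ℕ.m<m+n n ℕ.≤-refl)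
  2*≡+ : ∀ m → 2 * m ≡ m + m
  2*≡+ m = cong (m ℕ.+_) (ℕ.+-identityʳ m)
  lower : q n + q (n + 1) ≤ (2 * q (n + 1)) ⊓ (q n + q (n + M / 2))
  lower = ℕ.⊓-glb
    (ℕ.≤-trans (ℕ.+-monoˡ-≤ (q (n + 1)) (ℕ.<⇒≤ q<q)) (ℕ.≤-reflexive (sym (2*≡+ (q (n + 1))))))
    (ℕ.+-monoʳ-≤ (q n) (subst (λ h → q (n + 1) ≤ q (n + h)) (sym M/2) (q-mono 1≤2^d 2^d≤M)))
  strict : 2 * q n < q n + q (n + 1)
  strict = subst (_< q n + q (n + 1)) (sym (2*≡+ (q n))) (ℕ.+-monoʳ-< (q n) q<q)
  alternatives :
    ( q (n + M) ≥ 2 * q (n + 1)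
    ⊎ PairPartition M (λ j k → q (n + k) ≡ q n + q (n + j)) )
    × q (n + M) ≥ (2 * q (n + 1)) ⊓ (q n + q (n + M / 2))
  alternatives with 2 * q (n + 1) ℕ.≤? q (n + M)
  ... | yes large = inj₁ large , ℕ.≤-trans (ℕ.m⊓n≤m _ _) large
  ... | no ¬large = inj₂ (pairPartition R⇒S m) , ℕ.≤-trans (ℕ.m⊓n≤n (2 * q (n + 1)) _) half-bound
    where
    R : Fin M → Fin M → Set
    R i j = q (n + suc (toℕ j)) ≡ q (n + 0) + q (n + suc (toℕ i))
    open Matchings R
    m : Matching
    m = bestMatching b (IsBasis.spanning basis) 1≤n 1≤M
      (ℕ.≤-reflexive (2*≡+ M))
      (subst (q (n + M) <_) (2*≡+ (q (n + 1))) (ℕ.≰⇒> ¬large))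
    R⇒S : ∀ {i j} → R i j → q (n + suc (toℕ j)) ≡ q n + q (n + suc (toℕ i))
    R⇒S {i} r = trans r (cong (λ k → q k + q (n + suc (toℕ i))) (ℕ.+-identityʳ n))
    -- Index i of `Fin M` stands for the number i + 1, so i ≥ h means i + 1 ≥ M/2.
    h = ℕ.pred (2 ^ d)
    1+h : suc h ≡ 2 ^ d
    1+h = ℕ.suc-pred (2 ^ d) {{ℕ.m^n≢0 2 d}}
    half-bound : q n + q (n + M / 2) ≤ q (n + M)
    -- A pair {j, k} with j ≥ M/2 gives q_n + q_{n+M/2} ≤ q_n + q_{n+j} = q_{n+k} ≤ q_{n+M}.
    half-bound =
      let i , h≤i , _ , r = large-smaller-element m h (trans (2*≡+ (2 ^ d)) (sym (cong₂ _+_ 1+h 1+h)))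
      in ℕ.≤-trans
           (ℕ.+-monoʳ-≤ (q n) (q-mono (ℕ.≤-trans (ℕ.≤-reflexive (trans M/2 (sym 1+h))) (s≤s h≤i))
             (Fin.toℕ<n i)))
           (subst (_≤ q (n + M)) (R⇒S r) (q-mono (Fin.toℕ<n _) ℕ.≤-refl))
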